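{- Let $n\geq 2$. For any arithmetical structure on $S_n$ or on $K_n$, the invariant factor decomposition of its critical group has at most $n-2$ (nontrivial) components. Moreover, this bound is sharp: for each $n\ge 2$, both for $S_n$ and for $K_n$, there is an arithmetical structure whose critical group has exactly $n-2$ components in its invariant factor decomposition.
   Context: The invariant factor decomposition of a finite abelian group is its expression as $\bigoplus_{k=1}^t\mathbb{Z}/m_k\mathbb{Z}$ with $m_k>1$ and $m_k\mid m_{k+1}$; its number of components is $t$ (with $t=0$ for the trivial group). An arithmetical structure on a finite, connected, loopless graph $G$ with vertex set $V(G)$ is a pair $(\mathbf{d},\mathbf{r})$, where $\mathbf{r}=(r_v)_{v\in V(G)}$ consists of positive integers with no common factor, $\mathbf{d}=(d_v)_{v\in V(G)}$ consists of nonnegative integers, and for every vertex $v$ we have $r_vd_v=\sum r_u$, the sum being over all $u$ adjacent to $v$ (with multiplicity for multigraphs). Its critical group $\mathcal{K}(G;\mathbf{d},\mathbf{r})$ is the torsion part of the cokernel (over $\mathbb{Z}$) of the matrix $L(G,\mathbf{d})=\operatorname{diag}(\mathbf{d})-A(G)$, where $A(G)$ is the adjacency matrix of $G$. The star graph $S_n$ has $n$ leaves $v_1,\dotsc,v_n$, each joined by one edge to a central vertex $v_0$ (and no other edges). $K_n$ denotes the (simple) complete graph on $n$ vertices. -}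

module Defs where

open import Algebra.Bundles using (AbelianGroup)
import Algebra.Construct.DirectProduct as DirectProduct
import Algebra.Construct.Pointwise as Pointwise
import Algebra.Construct.Terminal as Terminal
open import Algebra.Definitions.RawMonoid using (sum)
open import Algebra.Morphism.Structures using (IsGroupIsomorphism)
import Algebra.Properties.AbelianGroup as AbelianGroupProperties
import Algebra.Properties.CommutativeMonoid.Mult as Mult
import Algebra.Properties.CommutativeSemigroup as CommutativeSemigroupProperties
import Algebra.Properties.Semiring.Sum as SemiringSum
open import Data.Bool.Base using (if_then_else_)
open import Data.Empty using (⊥-elim)
open import Data.Fin.Base using (Fin; zero; suc)
open import Data.Fin.Properties using (_≟_)
open import Data.Integer.Base as ℤ using (ℤ; +_)
import Data.Integer.Divisibility.Signed as ℤ∣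
import Data.Integer.Properties as ℤₚ
open import Data.List.Base using (List; foldr; length; map)
open import Data.List.Relation.Unary.All using (All)
open import Data.List.Relation.Unary.Linked using (Linked)
open import Data.Nat.Base as ℕ using (ℕ; suc; _<_; z<s)
open import Data.Nat.Divisibility using (_∣_)
import Data.Nat.Properties as ℕₚ
open import Data.Product.Base using (Σ; Σ-syntax; ∃-syntax; _×_; _,_; proj₁)
open import Data.Vec.Functional using (Vector)
open import Level using (0ℓ)
open import Relation.Binary.Construct.Closure.ReflexiveTransitive using (Star; ε; _◅_)
open import Relation.Binary.PropositionalEquality
  using (_≡_; _≢_; refl; sym; trans; cong; cong₂)
open import Relation.Nullary.Decidable using (does; yes; no)

Ab : Set₁
Ab = AbelianGroup 0ℓ 0ℓ

record Subgroup (A : Ab) : Set₁ where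
  open AbelianGroup A using (Carrier; _≈_; _∙_; _⁻¹) renaming (ε to e)
  field
    Member    : Carrier → Set
    resp      : ∀ {x y} → x ≈ y → Member x → Member y
    ε-closed  : Member e
    ∙-closed  : ∀ {x y} → Member x → Member y → Member (x ∙ y)
    ⁻¹-closed : ∀ {x} → Member x → Member (x ⁻¹)

subgroup : (A : Ab) → Subgroup A → Ab
subgroup A H = record
  { Carrier = Σ A.Carrier H.Member
  ; _≈_     = λ x y → proj₁ x A.≈ proj₁ y
  ; _∙_     = λ { (x , p) (y , q) → (x A.∙ y) , H.∙-closed p q }
  ; ε       = A.ε , H.ε-closed
  ; _⁻¹     = λ { (x , p) → (x A.⁻¹) , H.⁻¹-closed p }
  ; isAbelianGroup = record
    { isGroup = record
      { isMonoid = record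
        { isSemigroup = record
          { isMagma = record
            { isEquivalence = record { refl = A.refl ; sym = A.sym ; trans = A.trans }
            ; ∙-cong = A.∙-cong
            }
          ; assoc = λ x y z → A.assoc (proj₁ x) (proj₁ y) (proj₁ z)
          }
        ; identity = (λ x → A.identityˡ (proj₁ x)) , (λ x → A.identityʳ (proj₁ x))
        }
      ; inverse = (λ x → A.inverseˡ (proj₁ x)) , (λ x → A.inverseʳ (proj₁ x))
      ; ⁻¹-cong = A.⁻¹-cong
      }
    ; comm = λ x y → A.comm (proj₁ x) (proj₁ y)
    }
  }
  where
  module A = AbelianGroup A
  module H = Subgroup H

quotient : (A : Ab) → Subgroup A → Ab
quotient A H = record
  { Carrier = Carrier
  ; _≈_     = λ x y → Member (x ∙ y ⁻¹)
  ; _∙_     = _∙_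
  ; ε       = e
  ; _⁻¹     = _⁻¹
  ; isAbelianGroup = record
    { isGroup = record
      { isMonoid = record
        { isSemigroup = record
          { isMagma = record
            { isEquivalence = record
              { refl  = λ {x} → embed {x} {x} A.refl
              ; sym   = λ {x} {y} p → resp (⁻¹-anti-homo‿- x y) (⁻¹-closed p)
              ; trans = λ {x} {y} {z} p q → resp (telescope x y z) (∙-closed p q)
              }
            ; ∙-cong = λ {x} {y} {u} {v} p q → resp (regroup x y u v) (∙-closed p q)
            }
          ; assoc = λ x y z → embed (A.assoc x y z)
          }
        ; identity = (λ x → embed (A.identityˡ x)) , (λ x → embed (A.identityʳ x))
        }
      ; inverse = (λ x → embed (A.inverseˡ x)) , (λ x → embed (A.inverseʳ x))
      ; ⁻¹-cong = λ {x} {y} p → resp (A.sym (⁻¹-∙-comm x (y ⁻¹))) (⁻¹-closed p)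
      }
    ; comm = λ x y → embed (A.comm x y)
    }
  }
  where
  module A = AbelianGroup A
  open A using (Carrier; _≈_; _∙_; _⁻¹) renaming (ε to e)
  open Subgroup H
  open AbelianGroupProperties A using (⁻¹-anti-homo‿-; ⁻¹-∙-comm)
  open CommutativeSemigroupProperties A.commutativeSemigroup using (interchange)

  embed : ∀ {x y} → x ≈ y → Member (x ∙ y ⁻¹)
  embed {x} {y} x≈y =
    resp (A.trans (A.sym (A.inverseʳ y)) (A.∙-congʳ (A.sym x≈y))) ε-closed

  telescope : ∀ x y z → (x ∙ y ⁻¹) ∙ (y ∙ z ⁻¹) ≈ x ∙ z ⁻¹
  telescope x y z =
    A.trans (A.assoc x (y ⁻¹) (y ∙ z ⁻¹))
      (A.∙-congˡ (A.trans (A.sym (A.assoc (y ⁻¹) y (z ⁻¹)))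
        (A.trans (A.∙-congʳ (A.inverseˡ y)) (A.identityˡ (z ⁻¹)))))

  regroup : ∀ x y u v → (x ∙ y ⁻¹) ∙ (u ∙ v ⁻¹) ≈ (x ∙ u) ∙ (y ∙ v) ⁻¹
  regroup x y u v =
    A.trans (interchange x (y ⁻¹) u (v ⁻¹)) (A.∙-congˡ (⁻¹-∙-comm y v))

torsionSubgroup : (A : Ab) → Subgroup A
torsionSubgroup A = record
  { Member    = λ x → Σ[ k ∈ ℕ ] 0 < k × k · x ≈ e
  ; resp      = λ { x≈y (k , 0<k , kx≈0) →
                    k , 0<k , A.trans (×-congʳ k (A.sym x≈y)) kx≈0 }
  ; ε-closed  = 1 , z<s , A.identityʳ e
  ; ∙-closed  = λ { {x} {y} (k , 0<k , kx≈0) (l , 0<l , ly≈0) →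
                    k ℕ.* l , ℕₚ.*-mono-< 0<k 0<l
                    , A.trans (×-distrib-+ x y (k ℕ.* l))
                        (A.trans (A.∙-cong
                           (A.trans (×-congˡ (ℕₚ.*-comm k l)) (multiple l k kx≈0))
                           (multiple k l ly≈0))
                          (A.identityˡ e)) }
  ; ⁻¹-closed = λ { {x} (k , 0<k , kx≈0) →
                    k , 0<k , A.trans (·-⁻¹ k x) (A.trans (A.⁻¹-cong kx≈0) ε⁻¹≈ε) }
  }
  where
  module A = AbelianGroup A
  open A using (_≈_; _∙_; _⁻¹) renaming (ε to e)
  open Mult A.commutativeMonoid using (×-congʳ; ×-congˡ; ×-assocˡ; ×-distrib-+)
    renaming (_×_ to infixr 8 _·_)
  open AbelianGroupProperties A using (ε⁻¹≈ε; ⁻¹-∙-comm)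

  ·-ε : ∀ k → k · e ≈ e
  ·-ε 0       = A.refl
  ·-ε (suc k) = A.trans (A.identityˡ (k · e)) (·-ε k)

  ·-⁻¹ : ∀ k x → k · (x ⁻¹) ≈ (k · x) ⁻¹
  ·-⁻¹ 0       x = A.sym ε⁻¹≈ε
  ·-⁻¹ (suc k) x = A.trans (A.∙-congˡ (·-⁻¹ k x)) (⁻¹-∙-comm x (k · x))

  multiple : ∀ l k {x} → k · x ≈ e → (l ℕ.* k) · x ≈ e
  multiple l k {x} kx≈0 =
    A.trans (A.sym (×-assocˡ x l k)) (A.trans (×-congʳ l kx≈0) (·-ε l))

torsion : Ab → Ab
torsion A = subgroup A (torsionSubgroup A)

ℤ/_ : ℕ → Ab
ℤ/ m = quotient ℤₚ.+-0-abelianGroup record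
  { Member    = λ x → + m ℤ∣.∣ x
  ; resp      = λ { refl p → p }
  ; ε-closed  = ℤ∣.divides ℤ.0ℤ refl
  ; ∙-closed  = ℤ∣.∣m∣n⇒∣m+n
  ; ⁻¹-closed = ℤ∣.∣m⇒∣-m
  }

⨁ : List Ab → Ab
⨁ = foldr DirectProduct.abelianGroup Terminal.abelianGroup

record InvariantFactorDecomposition (A : Ab) : Set where
  field
    factors       : List ℕ
    factors>1     : All (1 <_) factors
    chain         : Linked _∣_ factors
    to            : AbelianGroup.Carrier A →
                    AbelianGroup.Carrier (⨁ (map ℤ/_ factors))
    isIsomorphism : IsGroupIsomorphism (AbelianGroup.rawGroup A)
                      (AbelianGroup.rawGroup (⨁ (map ℤ/_ factors))) to

  components : ℕ
  components = length factors

-- "The number of components of the invariant factor decomposition of A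
-- satisfies P".  The definite description is spelled out, so that nothing
-- depends on the structure theorem as background: a decomposition exists, and
-- every decomposition satisfies P.
NumberOfComponents : Ab → (ℕ → Set) → Set
NumberOfComponents A P =
  InvariantFactorDecomposition A ×
  (∀ (D : InvariantFactorDecomposition A) →
     P (InvariantFactorDecomposition.components D))

Matrix : ℕ → ℕ → Set
Matrix m n = Fin m → Fin n → ℤ

∑ℕ : ∀ {n} → Vector ℕ n → ℕ
∑ℕ = sum ℕ.+-0-rawMonoid

∑ℤ : ∀ {n} → Vector ℤ n → ℤ
∑ℤ = sum ℤ.+-0-rawMonoid

_*ᵥ_ : ∀ {m n} → Matrix m n → Vector ℤ n → Vector ℤ m
(M *ᵥ z) i = ∑ℤ (λ j → M i j ℤ.* z j)

ℤ^_ : ℕ → Ab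
ℤ^ n = Pointwise.abelianGroup (Fin n) ℤₚ.+-0-abelianGroup

image : ∀ {m n} → Matrix m n → Subgroup (ℤ^ m)
image {m} {n} M = record
  { Member    = λ x → ∃[ z ] (∀ i → x i ≡ (M *ᵥ z) i)
  ; resp      = λ { x≈y (z , p) → z , λ i → trans (sym (x≈y i)) (p i) }
  ; ε-closed  = (λ _ → ℤ.0ℤ) , λ i → sym (∑0 (M i))
  ; ∙-closed  = λ { (z , p) (w , q) →
                    (λ j → z j ℤ.+ w j)
                    , λ i → trans (cong₂ ℤ._+_ (p i) (q i)) (sym (∑+ (M i) z w)) }
  ; ⁻¹-closed = λ { (z , p) →
                    (λ j → ℤ.- z j)
                    , λ i → trans (cong ℤ.-_ (p i)) (sym (∑- (M i) z)) }
  }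
  where
  open SemiringSum ℤₚ.+-*-semiring using (sum-cong-≗; sum-replicate-zero; ∑-distrib-+)

  ∑0 : (a : Vector ℤ n) → ∑ℤ (λ j → a j ℤ.* ℤ.0ℤ) ≡ ℤ.0ℤ
  ∑0 a = trans (sum-cong-≗ {n} λ j → ℤₚ.*-zeroʳ (a j)) (sum-replicate-zero n)

  ∑+ : (a z w : Vector ℤ n) → ∑ℤ (λ j → a j ℤ.* (z j ℤ.+ w j)) ≡
       ∑ℤ (λ j → a j ℤ.* z j) ℤ.+ ∑ℤ (λ j → a j ℤ.* w j)
  ∑+ a z w = trans (sum-cong-≗ {n} λ j → ℤₚ.*-distribˡ-+ (a j) (z j) (w j))
                   (∑-distrib-+ (λ j → a j ℤ.* z j) (λ j → a j ℤ.* w j))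

  ∑- : ∀ {k} (a z : Vector ℤ k) →
       ∑ℤ (λ j → a j ℤ.* (ℤ.- z j)) ≡ ℤ.- ∑ℤ (λ j → a j ℤ.* z j)
  ∑- {0}     a z = refl
  ∑- {suc k} a z = trans
    (cong₂ ℤ._+_ (sym (ℤₚ.neg-distribʳ-* (a zero) (z zero)))
                 (∑- (λ j → a (suc j)) (λ j → z (suc j))))
    (sym (ℤₚ.neg-distrib-+ (a zero ℤ.* z zero)
                           (∑ℤ (λ j → a (suc j) ℤ.* z (suc j)))))

cokernel : ∀ {m n} → Matrix m n → Ab
cokernel {m} M = quotient (ℤ^ m) (image M)

-- adj u v is the number of edges between u and v.
record Graph : Set where
  field
    order     : ℕ
    adj       : Fin order → Fin order → ℕ
    symmetric : ∀ u v → adj u v ≡ adj v u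
    loopless  : ∀ v → adj v v ≡ 0
    connected : ∀ u v → Star (λ x y → 0 < adj x y) u v

record ArithmeticalStructure (G : Graph) : Set where
  open Graph G
  field
    d r        : Fin order → ℕ
    r-positive : ∀ v → 0 < r v
    r-coprime  : ∀ k → (∀ v → k ∣ r v) → k ≡ 1
    balanced   : ∀ v → r v ℕ.* d v ≡ ∑ℕ (λ u → adj v u ℕ.* r u)

  L : Matrix order order
  L u v = (if does (u ≟ v) then + d u else ℤ.0ℤ) ℤ.- + adj u v

criticalGroup : {G : Graph} → ArithmeticalStructure G → Ab
criticalGroup S = torsion (cokernel (ArithmeticalStructure.L S))

S[_] : ℕ → Graph
S[ n ] = record
  { order     = suc n
  ; adj       = adj
  ; symmetric = λ { zero zero → refl ; zero (suc _) → refl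
                  ; (suc _) zero → refl ; (suc _) (suc _) → refl }
  ; loopless  = λ { zero → refl ; (suc _) → refl }
  ; connected = λ { zero    zero    → ε
                  ; zero    (suc _) → z<s ◅ ε
                  ; (suc _) zero    → z<s ◅ ε
                  ; (suc _) (suc _) → _◅_ {j = zero} z<s (z<s ◅ ε) }
  }
  where
  adj : Fin (suc n) → Fin (suc n) → ℕ
  adj zero    zero    = 0
  adj zero    (suc _) = 1
  adj (suc _) zero    = 1
  adj (suc _) (suc _) = 0

K[_] : ℕ → Graph
K[ n ] = record
  { order     = n
  ; adj       = adj
  ; symmetric = symmetric
  ; loopless  = loopless
  ; connected = connected
  }
  where
  adj : Fin n → Fin n → ℕ
  adj u v = if does (u ≟ v) then 0 else 1

  symmetric : ∀ u v → adj u v ≡ adj v u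
  symmetric u v with u ≟ v | v ≟ u
  ... | yes _   | yes _   = refl
  ... | no _    | no _    = refl
  ... | yes u≡v | no v≢u  = ⊥-elim (v≢u (sym u≡v))
  ... | no u≢v  | yes v≡u = ⊥-elim (u≢v (sym v≡u))

  loopless : ∀ v → adj v v ≡ 0
  loopless v with v ≟ v
  ... | yes _  = refl
  ... | no v≢v = ⊥-elim (v≢v refl)

  edge : ∀ {u v} → u ≢ v → 0 < adj u v
  edge {u} {v} u≢v with u ≟ v
  ... | yes u≡v = ⊥-elim (u≢v u≡v)
  ... | no _    = z<s

  connected : ∀ u v → Star (λ x y → 0 < adj x y) u v
  connected u v with u ≟ v
  ... | yes refl = ε
  ... | no u≢v   = edge u≢v ◅ ε

{-# OPTIONS --safe #-}
module Submission where

-- The cokernel of L is brought to Smith form ⨁ ℤ/aᵢ, with one aᵢ ≥ 0 per vertex, and its torsion is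
-- the sum over the aᵢ > 1.  An edge of Kₙ gives a unit pivot, hence one aᵢ = 1, and two edges of Sₙ at
-- the centre give two; since r pairs to zero with the image of L, the cokernel is infinite and some
-- aᵢ = 0.  Both cases leave at most n − 2 components.
--
-- The number of components does not depend on the decomposition: if p is the first factor of one with
-- t factors and another has t′, then |A/pA| = p^t by the first and |A/pA| ≤ p^t′ by the second.
--
-- The bound is attained by r = (1, …, 1) on Kₙ and by r = (n, 1, …, 1) on Sₙ: there differences of
-- coordinates map the torsion of the cokernel onto (ℤ/n)ⁿ⁻².

open import Defs
open import Algebra.Bundles using (AbelianGroup)
open import Algebra.Construct.DirectProduct using () renaming (abelianGroup to _⊕_)
open import Algebra.Morphism.Structures using (IsGroupIsomorphism)
import Algebra.Properties.AbelianGroup as AbelianGroupProperties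
import Algebra.Properties.CommutativeMonoid.Mult as Mult
import Algebra.Properties.Semiring.Sum as SemiringSum
open import Data.Bool.Base using (if_then_else_)
open import Data.Empty using (⊥-elim)
open import Data.Fin.Base using (Fin; zero; suc; toℕ; fromℕ<; combine; punchIn; finToFun; funToFin)
open import Data.Fin.Properties
  using (_≟_; all?; ¬∀⟶∃¬; toℕ-fromℕ<; toℕ<n; toℕ-injective; punchIn-punchOut
        ; combine-injective; combine-surjective; funToFin-finToFin; injective⇒≤)
open import Data.Integer.Base as ℤ using (ℤ; +_; 0ℤ; 1ℤ; -1ℤ; ∣_∣; ≢-nonZero) renaming (-_ to neg)
open import Data.Integer.DivMod
  using (_/_; _%_; n%d<d; a≡a%n+[a/n]*n; _%ℕ_; _/ℕ_; n%ℕd<d; a≡a%ℕn+[a/ℕn]*n)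
import Data.Integer.Divisibility.Signed as ℤ∣
import Data.Integer.Properties as ℤₚ
open import Data.Integer.Tactic.RingSolver using (solve-∀)
open import Data.List.Base using (List; []; _∷_; map; filter; length)
open import Data.List.Properties using (filter-notAll)
open import Data.List.Relation.Unary.All using (All; []; _∷_)
open import Data.List.Relation.Unary.All.Properties using (all-filter; ¬All⇒Any¬)
import Data.List.Relation.Unary.Any as Any
open import Data.List.Relation.Unary.Linked as Linked using (Linked; [-]; _∷_)
import Data.List.Relation.Unary.Linked.Properties as Linkedₚ
open import Data.Nat.Base as ℕ
  using (ℕ; zero; suc; _<_; _≤_; _∸_; _^_; z≤n; s≤s; z<s; NonZero; >-nonZero)
open import Data.Nat.Divisibility using (_∣_; _∣0; ∣-refl; ∣-trans; ∣1⇒≡1; >⇒∤)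
open import Data.Nat.Induction using (Acc; acc; <-wellFounded)
import Data.Nat.Properties as ℕₚ
open import Data.Product.Base using (Σ-syntax; ∃-syntax; _×_; _,_; proj₁; proj₂)
open import Data.Sum.Base using (_⊎_; inj₁; inj₂)
open import Data.Vec.Functional using (Vector; insertAt)
open import Data.Vec.Functional.Properties using (insertAt-lookup; insertAt-punchIn)
open import Function.Base using (_∘_; id)
open import Relation.Binary.PropositionalEquality as ≡
  using (_≡_; _≢_; refl; sym; trans; subst; subst₂; cong; cong₂)
open import Relation.Nullary using (¬_)
open import Relation.Nullary.Decidable using (does; yes; no)

open AbelianGroupProperties ℤₚ.+-0-abelianGroup using () renaming (∙-cancelʳ to +-cancelʳ)
open SemiringSum ℤₚ.+-*-semiring
  using (sum-cong-≗; sum-replicate-zero; ∑-distrib-+; *-distribˡ-sum; *-distribʳ-sum; ∑-comm)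
open ≡.≡-Reasoning

-- Homomorphisms and isomorphisms of abelian groups

∣_∣ᴬ : Ab → Set
∣ A ∣ᴬ = AbelianGroup.Carrier A

module _ (A B : Ab) where
  private
    module A = AbelianGroup A
    module B = AbelianGroup B

  -- Only compatibility with the operation is a field; compatibility with the identity and with
  -- inverses follows from cancellation.
  record Hom : Set where
    field
      to     : A.Carrier → B.Carrier
      ≈-cong : ∀ {x y} → x A.≈ y → to x B.≈ to y
      ∙-homo : ∀ x y → to (x A.∙ y) B.≈ to x B.∙ to y

    ε-homo : to A.ε B.≈ B.ε
    ε-homo = identityˡ-unique (to A.ε) (to A.ε)
      (B.trans (B.sym (∙-homo A.ε A.ε)) (≈-cong (A.identityˡ A.ε)))
      where open AbelianGroupProperties B using (identityˡ-unique)

    ⁻¹-homo : ∀ x → to (x A.⁻¹) B.≈ to x B.⁻¹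
    ⁻¹-homo x = inverseˡ-unique (to (x A.⁻¹)) (to x)
      (B.trans (B.sym (∙-homo (x A.⁻¹) x)) (B.trans (≈-cong (A.inverseˡ x)) ε-homo))
      where open AbelianGroupProperties B using (inverseˡ-unique)

    //-homo : ∀ x y → to (x A.∙ y A.⁻¹) B.≈ to x B.∙ to y B.⁻¹
    //-homo x y = B.trans (∙-homo x (y A.⁻¹)) (B.∙-congˡ (⁻¹-homo y))

  infix 4 _≅_
  -- Injectivity is required only at the identity, which is what a kernel computation delivers;
  -- `injective` recovers the general case.
  record _≅_ : Set where
    field
      hom : Hom
    open Hom hom public
    field
      kernel : ∀ x → to x B.≈ B.ε → x A.≈ A.ε
      onto   : ∀ y → ∃[ x ] to x B.≈ y

    injective : ∀ {x y} → to x B.≈ to y → x A.≈ y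
    injective {x} {y} p = x∙y⁻¹≈ε⇒x≈y x y
      (kernel (x A.∙ y A.⁻¹) (B.trans (//-homo x y) (B.trans (B.∙-congʳ p) (B.inverseʳ (to y)))))
      where open AbelianGroupProperties A using (x∙y⁻¹≈ε⇒x≈y)

    isGroupIsomorphism : IsGroupIsomorphism A.rawGroup B.rawGroup to
    isGroupIsomorphism = record
      { isGroupMonomorphism = record
        { isGroupHomomorphism = record
          { isMonoidHomomorphism = record
            { isMagmaHomomorphism = record
              { isRelHomomorphism = record { cong = ≈-cong }
              ; homo = ∙-homo
              }
            ; ε-homo = ε-homo
            }
          ; ⁻¹-homo = ⁻¹-homo
          }
        ; injective = injective
        }
      ; surjective = λ y → let (x , p) = onto y in
          x , λ z≈x → B.trans (≈-cong z≈x) p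
      }

module _ {A B C : Ab} where
  private module C = AbelianGroup C

  _⟫_ : Hom A B → Hom B C → Hom A C
  f ⟫ g = record
    { to     = G.to ∘ F.to
    ; ≈-cong = G.≈-cong ∘ F.≈-cong
    ; ∙-homo = λ x y → C.trans (G.≈-cong (F.∙-homo x y)) (G.∙-homo (F.to x) (F.to y))
    }
    where
    module F = Hom f
    module G = Hom g

  infixr 4 _⨾_
  _⨾_ : A ≅ B → B ≅ C → A ≅ C
  f ⨾ g = record
    { hom    = F.hom ⟫ G.hom
    ; kernel = λ x → F.kernel x ∘ G.kernel (F.to x)
    ; onto   = λ z → let (y , gy≈z) = G.onto z
                         (x , fx≈y) = F.onto y
                     in x , C.trans (G.≈-cong fx≈y) gy≈z
    }
    where
    module F = _≅_ f
    module G = _≅_ g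

≅-refl : ∀ {A} → A ≅ A
≅-refl {A} = record
  { hom    = record { to = id ; ≈-cong = id ; ∙-homo = λ _ _ → A.refl }
  ; kernel = λ _ → id
  ; onto   = λ y → y , A.refl
  }
  where module A = AbelianGroup A

⊕-cong : ∀ {A A′ B B′} → A ≅ A′ → B ≅ B′ → A ⊕ B ≅ A′ ⊕ B′
⊕-cong f g = record
  { hom = record
    { to     = λ (x , y) → F.to x , G.to y
    ; ≈-cong = λ (p , q) → F.≈-cong p , G.≈-cong q
    ; ∙-homo = λ (x , y) (x′ , y′) → F.∙-homo x x′ , G.∙-homo y y′
    }
  ; kernel = λ (x , y) (p , q) → F.kernel x p , G.kernel y q
  ; onto   = λ (x , y) → (proj₁ (F.onto x) , proj₁ (G.onto y))
                         , (proj₂ (F.onto x) , proj₂ (G.onto y))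
  }
  where
  module F = _≅_ f
  module G = _≅_ g

Trivial : Ab → Set
Trivial A = ∀ x → x ≈ ε
  where open AbelianGroup A

⊕-trivialˡ : ∀ {A} B → Trivial A → A ⊕ B ≅ B
⊕-trivialˡ {A} B t = record
  { hom    = record { to = proj₂ ; ≈-cong = proj₂ ; ∙-homo = λ _ _ → B.refl }
  ; kernel = λ (x , _) y≈ε → t x , y≈ε
  ; onto   = λ y → (A.ε , y) , B.refl
  }
  where
  module A = AbelianGroup A
  module B = AbelianGroup B

-- Multiples and torsion

module _ (A : Ab) where
  open AbelianGroup A
  open Mult commutativeMonoid using () renaming (_×_ to infixr 8 _·′_)

  multiple : ℕ → Carrier → Carrier
  multiple k x = k ·′ x

  Torsion : Carrier → Set
  Torsion = Subgroup.Member (torsionSubgroup A)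

module _ {A B : Ab} (f : Hom A B) where
  private
    module A = AbelianGroup A
    module B = AbelianGroup B
  open Hom f

  multiple-homo : ∀ k x → to (multiple A k x) B.≈ multiple B k (to x)
  multiple-homo zero    x = ε-homo
  multiple-homo (suc k) x = B.trans (∙-homo x _) (B.∙-congˡ (multiple-homo k x))

  torsion-homo : ∀ {x} → Torsion A x → Torsion B (to x)
  torsion-homo {x} (k , 0<k , kx≈0) =
    k , 0<k , B.trans (B.sym (multiple-homo k x)) (B.trans (≈-cong kx≈0) ε-homo)

torsion-reflects : ∀ {A B} (f : A ≅ B) {x} → Torsion B (_≅_.to f x) → Torsion A x
torsion-reflects {B = B} f {x} (k , 0<k , kfx≈0) =
  k , 0<k , kernel _ (B.trans (multiple-homo hom k x) kfx≈0)
  where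
  open _≅_ f
  module B = AbelianGroup B

torsion-cong : ∀ {A B} → A ≅ B → torsion A ≅ torsion B
torsion-cong {A} {B} f = record
  { hom = record
    { to     = λ (x , p) → to x , torsion-homo hom p
    ; ≈-cong = ≈-cong
    ; ∙-homo = λ (x , _) (y , _) → ∙-homo x y
    }
  ; kernel = λ (x , _) → kernel x
  ; onto   = λ (y , p) → let (x , fx≈y) = onto y in
      (x , torsion-reflects {A} {B} f (Subgroup.resp (torsionSubgroup B) (B.sym fx≈y) p)) , fx≈y
  }
  where
  open _≅_ f
  module B = AbelianGroup B

torsion-inclusion : ∀ A → Hom (torsion A) A
torsion-inclusion A = record { to = proj₁ ; ≈-cong = id ; ∙-homo = λ _ _ → A.refl }
  where module A = AbelianGroup A

torsion-all : ∀ {A} → (∀ x → Torsion A x) → torsion A ≅ A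
torsion-all {A} t = record
  { hom    = torsion-inclusion A
  ; kernel = λ _ → id
  ; onto   = λ x → (x , t x) , A.refl
  }
  where module A = AbelianGroup A

module _ (A B : Ab) where
  private
    module A = AbelianGroup A
    module B = AbelianGroup B

  π₁ : Hom (A ⊕ B) A
  π₁ = record { to = proj₁ ; ≈-cong = proj₁ ; ∙-homo = λ _ _ → A.refl }

  π₂ : Hom (A ⊕ B) B
  π₂ = record { to = proj₂ ; ≈-cong = proj₂ ; ∙-homo = λ _ _ → B.refl }

  ι₁ : Hom A (A ⊕ B)
  ι₁ = record { to = _, B.ε ; ≈-cong = _, B.refl ; ∙-homo = λ _ _ → A.refl , B.sym (B.identityˡ B.ε) }

  ι₂ : Hom B (A ⊕ B)
  ι₂ = record { to = A.ε ,_ ; ≈-cong = A.refl ,_ ; ∙-homo = λ _ _ → A.sym (A.identityˡ A.ε) , B.refl }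

  -- The pair is the sum of `(x , ε)` and `(ε , y)`, and each of these is the image of a torsion
  -- element under an inclusion.
  torsion-pair : ∀ {x y} → Torsion A x → Torsion B y → Torsion (A ⊕ B) (x , y)
  torsion-pair {x} {y} p q = resp (A.identityʳ x , B.identityˡ y)
    (∙-closed (torsion-homo ι₁ p) (torsion-homo ι₂ q))
    where open Subgroup (torsionSubgroup (A ⊕ B))

  torsion-⊕ : torsion (A ⊕ B) ≅ torsion A ⊕ torsion B
  torsion-⊕ = record
    { hom = record
      { to     = λ ((x , y) , p) → (x , torsion-homo π₁ p) , (y , torsion-homo π₂ p)
      ; ≈-cong = id
      ; ∙-homo = λ _ _ → A.refl , B.refl
      }
    ; kernel = λ _ → id
    ; onto   = λ ((x , p) , (y , q)) → ((x , y) , torsion-pair p q) , (A.refl , B.refl)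
    }

-- Quotients and the first isomorphism theorem

module _ (A : Ab) (H : Subgroup A) where
  private
    module A = AbelianGroup A
    module Q = AbelianGroup (quotient A H)
    module H = Subgroup H
  open AbelianGroupProperties A using (x≈y⇒x∙y⁻¹≈ε; ε⁻¹≈ε)

  projection : Hom A (quotient A H)
  projection = record
    { to     = id
    ; ≈-cong = λ x≈y → H.resp (A.sym (x≈y⇒x∙y⁻¹≈ε x≈y)) H.ε-closed
    ; ∙-homo = λ x y → Q.refl {x A.∙ y}
    }

  private
    x//ε≈x : ∀ x → x A.∙ A.ε A.⁻¹ A.≈ x
    x//ε≈x x = A.trans (A.∙-congˡ ε⁻¹≈ε) (A.identityʳ x)

  member⇒≈ε : ∀ {x} → H.Member x → x Q.≈ Q.ε
  member⇒≈ε {x} = H.resp (A.sym (x//ε≈x x))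

  ≈ε⇒member : ∀ {x} → x Q.≈ Q.ε → H.Member x
  ≈ε⇒member {x} = H.resp (x//ε≈x x)

  -- A quotient has the carrier of `A` with a coarser equality, so `f` itself serves as the induced
  -- map.
  first-isomorphism : ∀ {B} → let module B = AbelianGroup B in (f : Hom A B) → let open Hom f in
    (∀ {x} → H.Member x → to x B.≈ B.ε) → (∀ {x} → to x B.≈ B.ε → H.Member x) →
    (∀ y → ∃[ x ] to x B.≈ y) → quotient A H ≅ B
  first-isomorphism {B} f H⊆ker ker⊆H onto = record
    { hom = record
      { to     = to
      ; ≈-cong = λ {x} {y} p → x∙y⁻¹≈ε⇒x≈y _ _ (B.trans (B.sym (//-homo x y)) (H⊆ker p))
      ; ∙-homo = ∙-homo
      }
    ; kernel = λ x p → member⇒≈ε (ker⊆H p)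
    ; onto   = onto
    }
    where
    module B = AbelianGroup B
    open AbelianGroupProperties B using (x∙y⁻¹≈ε⇒x≈y)
    open Hom f

-- Cyclic groups and their torsion

multiple-ℤ/ : ∀ m k x → multiple (ℤ/ m) k x ≡ + k ℤ.* x
multiple-ℤ/ m zero    x = refl
multiple-ℤ/ m (suc k) x = trans (cong (λ y → x ℤ.+ y) (multiple-ℤ/ m k x)) (sym (ℤₚ.suc-* (+ k) x))

ℤ/-torsion : ∀ m → 0 < m → ∀ x → Torsion (ℤ/ m) x
ℤ/-torsion m 0<m x = m , 0<m , ℤ∣.divides x
  (trans (ℤₚ.+-identityʳ _) (trans (multiple-ℤ/ m m x) (ℤₚ.*-comm (+ m) x)))

-- Divisibility by 0 is equality with 0, so `ℤ/ 0` is the group of integers, where a positive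
-- multiplier cancels.
torsion-ℤ-trivial : Trivial (torsion (ℤ/ 0))
torsion-ℤ-trivial (x , suc k , _ , p) = ℤ∣.∣-reflexive (sym (trans (ℤₚ.+-identityʳ x)
  (ℤₚ.*-cancelˡ-≡ (+ suc k) x 0ℤ (trans (sym (trans (ℤₚ.+-identityʳ _) (multiple-ℤ/ 0 (suc k) x)))
    (trans (ℤ∣.0∣⇒≡0 p) (sym (ℤₚ.*-zeroʳ (+ suc k))))))))

ℤ/1-trivial : Trivial (ℤ/ 1)
ℤ/1-trivial x = ℤ∣.divides (x ℤ.+ 0ℤ) (sym (ℤₚ.*-identityʳ _))

≡⇒≈-ℤ/ : ∀ m {x y} → x ≡ y → AbelianGroup._≈_ (ℤ/ m) x y
≡⇒≈-ℤ/ m eq = ℤ∣.divides 0ℤ (ℤₚ.i≡j⇒i-j≡0 eq)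

cyclics : List ℕ → Ab
cyclics = ⨁ ∘ map ℤ/_

nontrivial : List ℕ → List ℕ
nontrivial = filter (1 ℕₚ.<?_)

-- A summand `ℤ/ 0` has no torsion, `ℤ/ 1` is trivial, and every other summand is all torsion. Hence
-- exactly the factors above 1 survive.
torsion-cyclics : ∀ as → torsion (cyclics as) ≅ cyclics (nontrivial as)
torsion-cyclics []       = torsion-all {cyclics []} λ x → 1 , z<s , _
torsion-cyclics (a ∷ as) = torsion-⊕ (ℤ/ a) (cyclics as) ⨾ step a
  where
  step : ∀ a → torsion (ℤ/ a) ⊕ torsion (cyclics as) ≅ cyclics (nontrivial (a ∷ as))
  step 0             = ⊕-trivialˡ {torsion (ℤ/ 0)} (torsion (cyclics as)) torsion-ℤ-trivial ⨾ torsion-cyclics as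
  step 1             = ⊕-trivialˡ {torsion (ℤ/ 1)} (torsion (cyclics as)) (ℤ/1-trivial ∘ proj₁) ⨾ torsion-cyclics as
  step (suc (suc a)) = ⊕-cong (torsion-all {ℤ/ suc (suc a)} (ℤ/-torsion _ z<s)) (torsion-cyclics as)

cyclics-torsion : ∀ {as} → All (0 <_) as → ∀ x → Torsion (cyclics as) x
cyclics-torsion []          _        = 1 , z<s , _
cyclics-torsion {a ∷ as} (0<a ∷ 0<as) (x , xs) =
  torsion-pair (ℤ/ a) (cyclics as) (ℤ/-torsion a 0<a x) (cyclics-torsion 0<as xs)

-- Dropping the factors 0 and 1 keeps a divisibility chain, because divisibility is transitive.
torsion-decomposition : ∀ {A} as → Linked _∣_ as → A ≅ cyclics as → InvariantFactorDecomposition (torsion A)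
torsion-decomposition {A} as chain f = record
  { factors       = nontrivial as
  ; factors>1     = all-filter (1 ℕₚ.<?_) as
  ; chain         = Linkedₚ.filter⁺ (1 ℕₚ.<?_) ∣-trans chain
  ; to            = to
  ; isIsomorphism = isGroupIsomorphism
  }
  where open _≅_ (torsion-cong {A} {cyclics as} f ⨾ torsion-cyclics as)

-- Residues

-- The absolute value of the difference is at most the larger of `a` and `b`, hence below `p`, and
-- the only such multiple of `p` is 0.
∣-difference : ∀ {p a b} → a < p → b < p → + p ℤ∣.∣ + a ℤ.- + b → a ≡ b
∣-difference {p} {a} {b} a<p b<p p∣a-b = ℤₚ.+-injective (ℤₚ.i-j≡0⇒i≡j (+ a) (+ b)
  (ℤₚ.∣i∣≡0⇒i≡0 (n∣m<n⇒m≡0 bound (ℤ∣.∣⇒∣ᵤ p∣a-b))))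
  where
  n∣m<n⇒m≡0 : ∀ {m n} → m < n → n ∣ m → m ≡ 0
  n∣m<n⇒m≡0 {zero}  _   _   = refl
  n∣m<n⇒m≡0 {suc m} m<n n∣m = ⊥-elim (>⇒∤ m<n n∣m)

  bound : ℤ.∣ + a ℤ.- + b ∣ < p
  bound = ℕₚ.≤-<-trans (subst (λ z → ℤ.∣ z ∣ ≤ a ℕ.⊔ b) (sym (ℤₚ.m-n≡m⊖n a b)) (ℤₚ.∣m⊝n∣≤m⊔n a b))
    (ℕₚ.⊔-lub a<p b<p)

module _ (p : ℕ) .{{_ : NonZero p}} where

  residue : ℤ → Fin p
  residue x = fromℕ< (n%ℕd<d x p)

  ∣-residue : ∀ x → + p ℤ∣.∣ x ℤ.- + toℕ (residue x)
  ∣-residue x = ℤ∣.divides (x /ℕ p) (begin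
    x ℤ.- + toℕ (residue x)                            ≡⟨ cong (λ r → x ℤ.- + r) (toℕ-fromℕ< (n%ℕd<d x p)) ⟩
    x ℤ.- + (x %ℕ p)                                   ≡⟨ cong (ℤ._- + (x %ℕ p)) (a≡a%ℕn+[a/ℕn]*n x p) ⟩
    (+ (x %ℕ p) ℤ.+ (x /ℕ p) ℤ.* + p) ℤ.- + (x %ℕ p)   ≡⟨ cancel (+ (x %ℕ p)) _ ⟩
    (x /ℕ p) ℤ.* + p                                   ∎)
    where
    cancel : ∀ r s → (r ℤ.+ s) ℤ.- r ≡ s
    cancel = solve-∀

  residue-≡⇒∣ : ∀ x y → residue x ≡ residue y → + p ℤ∣.∣ x ℤ.- y
  residue-≡⇒∣ x y eq = subst (+ p ℤ∣.∣_) (rearrange x y _)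
    (ℤ∣.∣m∣n⇒∣m-n (∣-residue x) (subst (λ r → + p ℤ∣.∣ y ℤ.- + toℕ r) (sym eq) (∣-residue y)))
    where
    rearrange : ∀ x y r → (x ℤ.- r) ℤ.- (y ℤ.- r) ≡ x ℤ.- y
    rearrange = solve-∀

  ∣⇒residue-≡ : ∀ x y → + p ℤ∣.∣ x ℤ.- y → residue x ≡ residue y
  ∣⇒residue-≡ x y p∣x-y = toℕ-injective (∣-difference (toℕ<n _) (toℕ<n _)
    (subst (+ p ℤ∣.∣_) (rearrange x y _ _)
      (ℤ∣.∣m∣n⇒∣m-n p∣x-y (ℤ∣.∣m∣n⇒∣m-n (∣-residue x) (∣-residue y)))))
    where
    rearrange : ∀ x y r s → (x ℤ.- y) ℤ.- ((x ℤ.- r) ℤ.- (y ℤ.- s)) ≡ r ℤ.- s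
    rearrange = solve-∀

  residue-toℕ : ∀ i → residue (+ toℕ i) ≡ i
  residue-toℕ i = toℕ-injective (∣-difference (toℕ<n _) (toℕ<n i)
    (subst (+ p ℤ∣.∣_) (swap (+ toℕ i) (+ toℕ (residue (+ toℕ i)))) (ℤ∣.∣m⇒∣-m (∣-residue (+ toℕ i)))))
    where
    swap : ∀ x r → ℤ.- (x ℤ.- r) ≡ r ℤ.- x
    swap = solve-∀

  -- Equality in A/pA, stated on representatives in `A`.
  record Congruent (A : Ab) (x y : ∣ A ∣ᴬ) : Set where
    constructor by
    open AbelianGroup A
    field
      factor   : Carrier
      equation : x ≈ y ∙ multiple A p factor

  ≈⇒Congruent : ∀ A {x y} → AbelianGroup._≈_ A x y → Congruent A x y
  ≈⇒Congruent A {x} {y} x≈y = by ε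
    (A.trans x≈y (A.sym (A.trans (A.∙-congˡ (×-idem (A.identityˡ ε) p)) (A.identityʳ y))))
    where
    module A = AbelianGroup A
    open A using (ε)
    open Mult A.commutativeMonoid using (×-idem)

  Congruent-cong : ∀ {A B} (f : Hom A B) {x y} → Congruent A x y → Congruent B (Hom.to f x) (Hom.to f y)
  Congruent-cong {B = B} f (by u eq) = by (to u) (B.trans (≈-cong eq) (B.trans (∙-homo _ _) (B.∙-congˡ (multiple-homo f p u))))
    where
    open Hom f
    module B = AbelianGroup B

  -- Surjectivity lifts the factor to `A`, and injectivity then pulls the equation back.
  Congruent-reflect : ∀ {A B} (f : A ≅ B) {x y} → Congruent B (_≅_.to f x) (_≅_.to f y) → Congruent A x y
  Congruent-reflect {B = B} f (by v eq) with u , fu≈v ← _≅_.onto f v = by u (injective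
    (B.trans eq (B.trans (B.∙-congˡ (B.trans (×-congʳ p (B.sym fu≈v)) (B.sym (multiple-homo hom p u))))
      (B.sym (∙-homo _ _)))))
    where
    open _≅_ f
    module B = AbelianGroup B
    open Mult B.commutativeMonoid using (×-congʳ)

  Congruent-⊕ : ∀ {A B x y x′ y′} → Congruent A x x′ → Congruent B y y′ → Congruent (A ⊕ B) (x , y) (x′ , y′)
  Congruent-⊕ {A} {B} (by u eq) (by v eq′) = by (u , v)
    (A.trans eq (A.∙-congˡ (A.sym (multiple-homo (π₁ A B) p (u , v)))) ,
     B.trans eq′ (B.∙-congˡ (B.sym (multiple-homo (π₂ A B) p (u , v)))))
    where
    module A = AbelianGroup A
    module B = AbelianGroup B

  -- The residues of all coordinates are packed into one `Fin`, so that sizes of quotients A/pA are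
  -- compared through injections between finite sets.
  residues : ∀ as → ∣ cyclics as ∣ᴬ → Fin (p ^ length as)
  residues []       _        = zero
  residues (a ∷ as) (x , xs) = combine (residue x) (residues as xs)

  ∣⇒Congruent-ℤ/ : ∀ a {x y} → + p ℤ∣.∣ x ℤ.- y → Congruent (ℤ/ a) x y
  ∣⇒Congruent-ℤ/ a {x} {y} (ℤ∣.divides u eq) = by u (≡⇒≈-ℤ/ a (begin
    x                             ≡⟨ expand x y ⟩
    y ℤ.+ (x ℤ.- y)               ≡⟨ cong (λ z → y ℤ.+ z) (trans eq (ℤₚ.*-comm u (+ p))) ⟩
    y ℤ.+ + p ℤ.* u               ≡⟨ cong (λ z → y ℤ.+ z) (multiple-ℤ/ a p u) ⟨
    y ℤ.+ multiple (ℤ/ a) p u     ∎))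
    where
    expand : ∀ x y → x ≡ y ℤ.+ (x ℤ.- y)
    expand = solve-∀

  -- Integers with equal residues differ by a multiple of `p` before any reduction modulo the
  -- factors. This gives the upper estimate of A/pA for an arbitrary list `as`.
  residues-≡⇒Congruent : ∀ as {x y} → residues as x ≡ residues as y → Congruent (cyclics as) x y
  residues-≡⇒Congruent []       _  = by _ _
  residues-≡⇒Congruent (a ∷ as) {x , xs} {y , ys} eq
    with eqₕ , eqₜ ← combine-injective (residue x) (residues as xs) (residue y) (residues as ys) eq =
    Congruent-⊕ {ℤ/ a} {cyclics as} (∣⇒Congruent-ℤ/ a (residue-≡⇒∣ x y eqₕ)) (residues-≡⇒Congruent as eqₜ)

  -- The residue modulo `p` is well defined on `ℤ/ a` because `p` divides `a`. This gives the exact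
  -- size of A/pA when `p` divides every factor.
  Congruent-ℤ/⇒≡ : ∀ {a} → p ∣ a → ∀ {x y} → Congruent (ℤ/ a) x y → residue x ≡ residue y
  Congruent-ℤ/⇒≡ {a} p∣a {x} {y} (by u a∣) = ∣⇒residue-≡ x y (subst (+ p ℤ∣.∣_) (expand x y _)
    (ℤ∣.∣m∣n⇒∣m+n (ℤ∣.∣-trans (ℤ∣.∣ᵤ⇒∣ p∣a) a∣)
      (ℤ∣.divides u (trans (multiple-ℤ/ a p u) (ℤₚ.*-comm (+ p) u)))))
    where
    expand : ∀ x y m → (x ℤ.- (y ℤ.+ m)) ℤ.+ m ≡ x ℤ.- y
    expand = solve-∀

  Congruent⇒residues-≡ : ∀ {as} → All (p ∣_) as → ∀ {x y} → Congruent (cyclics as) x y →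
    residues as x ≡ residues as y
  Congruent⇒residues-≡ []             _ = refl
  Congruent⇒residues-≡ {a ∷ as} (p∣a ∷ p∣as) {x , xs} {y , ys} c = cong₂ combine
    (Congruent-ℤ/⇒≡ p∣a (Congruent-cong (π₁ (ℤ/ a) (cyclics as)) c))
    (Congruent⇒residues-≡ p∣as (Congruent-cong (π₂ (ℤ/ a) (cyclics as)) c))

  residues-surjective : ∀ as k → ∃[ x ] residues as x ≡ k
  residues-surjective []       zero = _ , refl
  residues-surjective (a ∷ as) k
    with i , j , refl ← combine-surjective {p} k
    with xs , eq ← residues-surjective as j = (+ toℕ i , xs) , cong₂ combine (residue-toℕ i) eq

  -- An isomorphism identifies A/pA with the quotient of the sum, which has at most p elements per factor.
  quotient-bound : ∀ {A k} as → A ≅ cyclics as → (s : ∣ A ∣ᴬ → Fin k) →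
    (∀ {x y} → Congruent A x y → s x ≡ s y) → (∀ i → ∃[ x ] s x ≡ i) → k ≤ p ^ length as
  quotient-bound {A} as f s s-cong s-onto = injective⇒≤ {f = residues as ∘ to ∘ proj₁ ∘ s-onto} λ {i} {j} eq →
    trans (sym (proj₂ (s-onto i))) (trans
      (s-cong (Congruent-reflect {A} {cyclics as} f (residues-≡⇒Congruent as eq)))
      (proj₂ (s-onto j)))
    where open _≅_ f

-- Dot products and basis vectors

dot : ∀ {n} → Vector ℤ n → Vector ℤ n → ℤ
dot a z = ∑ℤ λ j → a j ℤ.* z j

dot-comm : ∀ {n} (a z : Vector ℤ n) → dot a z ≡ dot z a
dot-comm {n} a z = sum-cong-≗ {n} λ j → ℤₚ.*-comm (a j) (z j)

dot-scale : ∀ {n} {a b : Vector ℤ n} c z → (∀ j → a j ≡ c ℤ.* b j) → dot a z ≡ c ℤ.* dot b z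
dot-scale {n} {a} {b} c z a≡cb = begin
  dot a z                            ≡⟨ sum-cong-≗ {n} (λ j → trans (cong (ℤ._* z j) (a≡cb j)) (ℤₚ.*-assoc c (b j) (z j))) ⟩
  ∑ℤ (λ j → c ℤ.* (b j ℤ.* z j))     ≡⟨ *-distribˡ-sum c (λ j → b j ℤ.* z j) ⟨
  c ℤ.* dot b z                      ∎

dot-linearˡ : ∀ {n} (a b : Vector ℤ n) c z → dot (λ j → a j ℤ.+ c ℤ.* b j) z ≡ dot a z ℤ.+ c ℤ.* dot b z
dot-linearˡ {n} a b c z = begin
  dot (λ j → a j ℤ.+ c ℤ.* b j) z           ≡⟨ sum-cong-≗ {n} (λ j → ℤₚ.*-distribʳ-+ (z j) (a j) (c ℤ.* b j)) ⟩
  ∑ℤ (λ j → a j ℤ.* z j ℤ.+ c ℤ.* b j ℤ.* z j)  ≡⟨ ∑-distrib-+ (λ j → a j ℤ.* z j) (λ j → c ℤ.* b j ℤ.* z j) ⟩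
  dot a z ℤ.+ dot (λ j → c ℤ.* b j) z       ≡⟨ cong (λ s → dot a z ℤ.+ s) (dot-scale c z λ _ → refl) ⟩
  dot a z ℤ.+ c ℤ.* dot b z                 ∎

dot-linearʳ : ∀ {n} (a y : Vector ℤ n) c z → dot a (λ j → y j ℤ.+ c ℤ.* z j) ≡ dot a y ℤ.+ c ℤ.* dot a z
dot-linearʳ a y c z = begin
  dot a (λ j → y j ℤ.+ c ℤ.* z j)    ≡⟨ dot-comm a _ ⟩
  dot (λ j → y j ℤ.+ c ℤ.* z j) a    ≡⟨ dot-linearˡ y z c a ⟩
  dot y a ℤ.+ c ℤ.* dot z a          ≡⟨ cong₂ (λ s t → s ℤ.+ c ℤ.* t) (dot-comm y a) (dot-comm z a) ⟩
  dot a y ℤ.+ c ℤ.* dot a z          ∎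

∣-dot : ∀ {n g} {a : Vector ℤ n} z → (∀ j → g ℤ∣.∣ a j) → g ℤ∣.∣ dot a z
∣-dot {g = g} {a} z g∣a = ℤ∣.divides (dot q z) (trans (dot-scale g z scaled) (ℤₚ.*-comm g (dot q z)))
  where
  q = ℤ∣.quotient ∘ g∣a

  scaled : ∀ j → a j ≡ g ℤ.* q j
  scaled j = trans (ℤ∣._∣_.equality (g∣a j)) (ℤₚ.*-comm (q j) g)

δ : ∀ {n} → Fin n → Vector ℤ n
δ i j = if does (i ≟ j) then 1ℤ else 0ℤ

δ-diagonal : ∀ {n} (i : Fin n) → δ i i ≡ 1ℤ
δ-diagonal i with i ≟ i
... | yes _  = refl
... | no i≢i = ⊥-elim (i≢i refl)

δ-off-diagonal : ∀ {n} {i j : Fin n} → i ≢ j → δ i j ≡ 0ℤ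
δ-off-diagonal {i = i} {j} i≢j with i ≟ j
... | yes i≡j = ⊥-elim (i≢j i≡j)
... | no _    = refl

dot-zeroʳ : ∀ {n} (a : Vector ℤ n) → dot a (λ _ → 0ℤ) ≡ 0ℤ
dot-zeroʳ {n} a = trans (sum-cong-≗ {n} λ j → ℤₚ.*-zeroʳ (a j)) (sum-replicate-zero n)

dot-δ : ∀ {n} (a : Vector ℤ n) i → dot a (δ i) ≡ a i
dot-δ a zero    = trans (cong₂ ℤ._+_ (ℤₚ.*-identityʳ (a zero)) (dot-zeroʳ (a ∘ suc))) (ℤₚ.+-identityʳ _)
dot-δ a (suc i) = trans (cong₂ ℤ._+_ (ℤₚ.*-zeroʳ (a zero)) (dot-δ (a ∘ suc) i)) (ℤₚ.+-identityˡ _)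

coker-hom : ∀ {m k n} (M : Matrix k n) (φ : Vector ℤ m → Vector ℤ k) →
  (∀ {x y} → (∀ i → x i ≡ y i) → ∀ j → φ x j ≡ φ y j) →
  (∀ x y j → φ (λ i → x i ℤ.+ y i) j ≡ φ x j ℤ.+ φ y j) → Hom (ℤ^ m) (cokernel M)
coker-hom {m} {k} M φ φ-cong φ-homo =
  record { to = φ ; ≈-cong = φ-cong ; ∙-homo = φ-homo } ⟫ projection (ℤ^ k) (image M)

-- Row operations

shear : ∀ {m n} → Vector ℤ m → Fin m → Matrix m n → Matrix m n
shear c i M k l = M k l ℤ.+ c k ℤ.* M i l

-- The map `φ` performs the same row operation on vectors and carries the image of `M` to that of
-- the sheared matrix. Since `c i` is 0, coordinate `i` stays fixed, and subtracting the same
-- multiples of it undoes `φ`.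
shear-cokernel : ∀ {m n} (c : Vector ℤ m) i → c i ≡ 0ℤ → (M : Matrix m n) → cokernel M ≅ cokernel (shear c i M)
shear-cokernel {m} {n} c i cᵢ≡0 M = first-isomorphism (ℤ^ m) (image M)
  (coker-hom (shear c i M) φ
    (λ x≈y k → cong₂ (λ s t → s ℤ.+ c k ℤ.* t) (x≈y k) (x≈y i))
    (λ x y k → additive (x k) (y k) (c k) (x i) (y i)))
  (λ {x} (z , x≡Mz) → member⇒≈ε (ℤ^ m) (image (shear c i M)) {φ x} (z , λ k →
    trans (cong₂ (λ s t → s ℤ.+ c k ℤ.* t) (x≡Mz k) (x≡Mz i)) (sym (dot-linearˡ (M k) (M i) (c k) z))))
  (λ {x} p → kernel x (≈ε⇒member (ℤ^ m) (image (shear c i M)) {φ x} p))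
  (λ y → (λ k → y k ℤ.- c k ℤ.* y i) , Hom.≈-cong (projection (ℤ^ m) (image (shear c i M))) (onto y))
  where
  φ : Vector ℤ m → Vector ℤ m
  φ x k = x k ℤ.+ c k ℤ.* x i

  additive : ∀ x y c s t → (x ℤ.+ y) ℤ.+ c ℤ.* (s ℤ.+ t) ≡ (x ℤ.+ c ℤ.* s) ℤ.+ (y ℤ.+ c ℤ.* t)
  additive = solve-∀

  φ-fixes : ∀ x → φ x i ≡ x i
  φ-fixes x = trans (cong (λ s → x i ℤ.+ s ℤ.* x i) cᵢ≡0) (ℤₚ.+-identityʳ (x i))

  kernel : ∀ x → Subgroup.Member (image (shear c i M)) (φ x) → Subgroup.Member (image M) x
  kernel x (z , p) = z , λ k → +-cancelʳ _ (x k) _ (begin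
    x k ℤ.+ c k ℤ.* x i                          ≡⟨ p k ⟩
    (shear c i M *ᵥ z) k                         ≡⟨ dot-linearˡ (M k) (M i) (c k) z ⟩
    (M *ᵥ z) k ℤ.+ c k ℤ.* (M *ᵥ z) i            ≡⟨ cong (λ s → (M *ᵥ z) k ℤ.+ c k ℤ.* s) xᵢ ⟨
    (M *ᵥ z) k ℤ.+ c k ℤ.* x i                   ∎)
    where
    xᵢ : x i ≡ (M *ᵥ z) i
    xᵢ = trans (sym (φ-fixes x)) (trans (p i) (trans (dot-linearˡ (M i) (M i) (c i) z) (φ-fixes (M *ᵥ z))))

  onto : ∀ y k → φ (λ k → y k ℤ.- c k ℤ.* y i) k ≡ y k
  onto y k = begin
    (y k ℤ.- c k ℤ.* y i) ℤ.+ c k ℤ.* (y i ℤ.- c i ℤ.* y i) ≡⟨ cong (λ s → (y k ℤ.- c k ℤ.* y i) ℤ.+ c k ℤ.* (y i ℤ.- s ℤ.* y i)) cᵢ≡0 ⟩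
    (y k ℤ.- c k ℤ.* y i) ℤ.+ c k ℤ.* (y i ℤ.- 0ℤ)          ≡⟨ cancel (y k) (c k) (y i) ⟩
    y k                                                      ∎
    where
    cancel : ∀ y c s → (y ℤ.- c ℤ.* s) ℤ.+ c ℤ.* (s ℤ.- 0ℤ) ≡ y
    cancel = solve-∀

-- M has a combination v of columns and a row i that are multiples of a = (M v)ᵢ.
record Pivot {m n} (M : Matrix (suc m) n) : Set where
  field
    a      : ℤ
    i      : Fin (suc m)
    v      : Vector ℤ n
    y      : Vector ℤ (suc m)
    w      : Vector ℤ n
    yᵢ≡1   : y i ≡ 1ℤ
    row    : ∀ l → M i l ≡ a ℤ.* w l
    column : ∀ k → (M *ᵥ v) k ≡ a ℤ.* y k

  pivot-entry : (M *ᵥ v) i ≡ a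
  pivot-entry = trans (column i) (trans (cong (a ℤ.*_) yᵢ≡1) (ℤₚ.*-identityʳ a))

  -- No column is removed: the combination v of the columns of rest vanishes, which is harmless.
  rest : Matrix m n
  rest k l = M (punchIn i k) l ℤ.+ neg (y (punchIn i k)) ℤ.* M i l

  private
    -- Clears coordinate `i`, where `y` is 1, and sends `M *ᵥ v`, which is `a` times `y`, to zero.
    φ : Vector ℤ (suc m) → Vector ℤ (suc m)
    φ x k = x k ℤ.+ neg (y k) ℤ.* x i

    additive : ∀ x x′ c s t → (x ℤ.+ x′) ℤ.+ c ℤ.* (s ℤ.+ t) ≡ (x ℤ.+ c ℤ.* s) ℤ.+ (x′ ℤ.+ c ℤ.* t)
    additive = solve-∀

    φ-M : ∀ z k → φ (M *ᵥ z) k ≡ dot (λ l → M k l ℤ.+ neg (y k) ℤ.* M i l) z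
    φ-M z k = sym (dot-linearˡ (M k) (M i) (neg (y k)) z)

    φ-kills : ∀ x → φ x i ≡ 0ℤ
    φ-kills x = trans (cong (λ s → x i ℤ.+ neg s ℤ.* x i) yᵢ≡1) (vanish (x i))
      where
      vanish : ∀ s → s ℤ.+ neg 1ℤ ℤ.* s ≡ 0ℤ
      vanish = solve-∀

    at-every-index : {P : Fin (suc m) → Set} → P i → (∀ k → P (punchIn i k)) → ∀ k → P k
    at-every-index {P} pᵢ p k with i ≟ k
    ... | yes refl = pᵢ
    ... | no i≢k   = subst P (punchIn-punchOut i≢k) (p _)

    -- On the image of `M`, coordinate `i` is a multiple of `a`, and the other coordinates after `φ`
    -- form the image of `rest`. So the two parts are read off separately.
    split : Hom (ℤ^ suc m) ((ℤ/ ∣ a ∣) ⊕ cokernel rest)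
    split = record
      { to     = λ x → x i , Hom.to rest-hom x
      ; ≈-cong = λ {x} {x′} x≈x′ → ≡⇒≈-ℤ/ ∣ a ∣ (x≈x′ i) , Hom.≈-cong rest-hom {x} {x′} x≈x′
      ; ∙-homo = λ x x′ → AbelianGroup.refl (ℤ/ ∣ a ∣) {x i ℤ.+ x′ i} , Hom.∙-homo rest-hom x x′
      }
      where
      rest-hom : Hom (ℤ^ suc m) (cokernel rest)
      rest-hom = coker-hom rest (λ x k → φ x (punchIn i k))
        (λ x≈x′ k → cong₂ (λ s t → s ℤ.+ neg (y (punchIn i k)) ℤ.* t) (x≈x′ (punchIn i k)) (x≈x′ i))
        (λ x x′ k → additive (x (punchIn i k)) (x′ (punchIn i k)) (neg (y (punchIn i k))) (x i) (x′ i))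

    module Split = Hom split
    module Target = AbelianGroup ((ℤ/ ∣ a ∣) ⊕ cokernel rest)

    row-multiple : ∀ z → (M *ᵥ z) i ≡ a ℤ.* dot w z
    row-multiple z = dot-scale a z row

    split-kills : ∀ {x} → Subgroup.Member (image M) x → Split.to x Target.≈ Target.ε
    split-kills {x} (z , x≡Mz) =
      subst (+ ∣ a ∣ ℤ∣.∣_) (sym (trans (ℤₚ.+-identityʳ (x i)) (trans (x≡Mz i) (row-multiple z))))
        (ℤ∣.∣m⇒∣m*n (dot w z) (ℤ∣.∣m∣∣m {a}))
      , member⇒≈ε (ℤ^ m) (image rest) {λ k → φ x (punchIn i k)} (z , λ k →
          trans (cong₂ (λ s t → s ℤ.+ neg (y (punchIn i k)) ℤ.* t) (x≡Mz (punchIn i k)) (x≡Mz i))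
                (φ-M z (punchIn i k)))

    -- Adding a multiple of v to z corrects the i-th entry of M z without changing φ (M z).
    split-kernel : ∀ {x} → Split.to x Target.≈ Target.ε → Subgroup.Member (image M) x
    split-kernel {x} (a∣xᵢ , x-rest)
      with z , p ← ≈ε⇒member (ℤ^ m) (image rest) {λ k → φ x (punchIn i k)} x-rest
      with ℤ∣.divides t xᵢ≡ta ← ℤ∣.∣-trans (ℤ∣.m∣∣m∣ {a}) a∣xᵢ =
      (λ l → z l ℤ.+ c t z ℤ.* v l) , λ k → +-cancelʳ (neg (y k) ℤ.* x i) (x k) _ (begin
        x k ℤ.+ neg (y k) ℤ.* x i
          ≡⟨ φx≡φMz k ⟩
        (M *ᵥ z) k ℤ.+ neg (y k) ℤ.* (M *ᵥ z) i
          ≡⟨ cong (λ s → (M *ᵥ z) k ℤ.+ neg (y k) ℤ.* s) (row-multiple z) ⟩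
        (M *ᵥ z) k ℤ.+ neg (y k) ℤ.* (a ℤ.* dot w z)
          ≡⟨ correct ((M *ᵥ z) k) (y k) a (dot w z) t ⟩
        ((M *ᵥ z) k ℤ.+ c t z ℤ.* (a ℤ.* y k)) ℤ.+ neg (y k) ℤ.* (t ℤ.* a)
          ≡⟨ cong₂ (λ s r → ((M *ᵥ z) k ℤ.+ c t z ℤ.* s) ℤ.+ neg (y k) ℤ.* r)
               (column k) (trans (sym (ℤₚ.+-identityʳ (x i))) xᵢ≡ta) ⟨
        ((M *ᵥ z) k ℤ.+ c t z ℤ.* (M *ᵥ v) k) ℤ.+ neg (y k) ℤ.* x i
          ≡⟨ cong (ℤ._+ neg (y k) ℤ.* x i) (dot-linearʳ (M k) z (c t z) v) ⟨
        (M *ᵥ (λ l → z l ℤ.+ c t z ℤ.* v l)) k ℤ.+ neg (y k) ℤ.* x i ∎)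
      where
      -- Entry `i` should be `t` times `a` and is `dot w z` times `a`; each copy of `v` contributes
      -- one `a`.
      c : ℤ → Vector ℤ n → ℤ
      c t z = t ℤ.- dot w z

      φx≡φMz : ∀ k → φ x k ≡ φ (M *ᵥ z) k
      φx≡φMz = at-every-index (trans (φ-kills x) (sym (φ-kills (M *ᵥ z))))
        λ k → trans (p k) (sym (φ-M z (punchIn i k)))

      correct : ∀ b y a s t → b ℤ.+ neg y ℤ.* (a ℤ.* s) ≡
        (b ℤ.+ (t ℤ.- s) ℤ.* (a ℤ.* y)) ℤ.+ neg y ℤ.* (t ℤ.* a)
      correct = solve-∀

    split-onto : ∀ t → ∃[ x ] Split.to x Target.≈ t
    split-onto (s , x′) = x , ≡⇒≈-ℤ/ ∣ a ∣ xᵢ≡s , Hom.≈-cong (projection (ℤ^ m) (image rest)) λ k → begin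
      x (punchIn i k) ℤ.+ neg (y (punchIn i k)) ℤ.* x i
        ≡⟨ cong₂ (λ r t → r ℤ.+ neg (y (punchIn i k)) ℤ.* t) (insertAt-punchIn lifted i s k) xᵢ≡s ⟩
      (x′ k ℤ.+ y (punchIn i k) ℤ.* s) ℤ.+ neg (y (punchIn i k)) ℤ.* s
        ≡⟨ cancel (x′ k) (y (punchIn i k)) s ⟩
      x′ k ∎
      where
      -- The added multiple of `s` is the one that `φ` subtracts again.
      lifted : Vector ℤ m
      lifted k = x′ k ℤ.+ y (punchIn i k) ℤ.* s

      x : Vector ℤ (suc m)
      x = insertAt lifted i s

      xᵢ≡s : x i ≡ s
      xᵢ≡s = insertAt-lookup lifted i s

      cancel : ∀ x y s → (x ℤ.+ y ℤ.* s) ℤ.+ neg y ℤ.* s ≡ x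
      cancel = solve-∀

  cokernel-split : cokernel M ≅ (ℤ/ ∣ a ∣) ⊕ cokernel rest
  cokernel-split = first-isomorphism (ℤ^ suc m) (image M) split
    (λ {x} → split-kills {x}) (λ {x} → split-kernel {x}) split-onto

open Pivot using (rest; cokernel-split)

-- Smith normal form

Divides : ∀ {m n} → ℤ → Matrix m n → Set
Divides g M = ∀ k l → g ℤ∣.∣ M k l

shear-Divides : ∀ {m n g} c i {M : Matrix m n} → Divides g M → Divides g (shear c i M)
shear-Divides c i g∣M k l = ℤ∣.∣m∣n⇒∣m+n (g∣M k l) (ℤ∣.∣n⇒∣m*n (c k) (g∣M i l))

-- Factors 0 and 1 are kept, one factor per row, so that their number is known in advance. The bound
-- `g` at the head of the chain is what allows a pivot dividing the remaining matrix to be put in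
-- front.
record Smith {m n} (g : ℕ) (M : Matrix m n) : Set where
  field
    factors   : List ℕ
    length≡m  : length factors ≡ m
    chain     : Linked _∣_ (g ∷ factors)
    decompose : cokernel M ≅ cyclics factors

pivot-Smith : ∀ {m n g} {M : Matrix (suc m) n} (P : Pivot M) → g ∣ ∣ Pivot.a P ∣ →
  Smith ∣ Pivot.a P ∣ (rest P) → Smith g M
pivot-Smith P g∣a S = record
  { factors   = ∣ Pivot.a P ∣ ∷ factors
  ; length≡m  = cong suc length≡m
  ; chain     = g∣a ∷ chain
  ; decompose = cokernel-split P ⨾ ⊕-cong (≅-refl {ℤ/ ∣ Pivot.a P ∣}) decompose
  }
  where open Smith S

rest-Divides : ∀ {m n g} {M : Matrix (suc m) n} (P : Pivot M) → Divides g M → Divides g (rest P)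
rest-Divides P g∣M k l = ℤ∣.∣m∣n⇒∣m+n (g∣M (punchIn i k) l) (ℤ∣.∣n⇒∣m*n (neg (y (punchIn i k))) (g∣M i l))
  where open Pivot P using (i; y)

-- Only row operations change the matrix. Column operations are recorded in `v`, and the descent is
-- on the size of an entry of `M′ *ᵥ v`.
record Improvement {m n} (M : Matrix m n) (b : ℕ) : Set where
  field
    M′       : Matrix m n
    same     : cokernel M ≅ cokernel M′
    divides  : ∀ {g} → Divides g M → Divides g M′
    i        : Fin m
    v        : Vector ℤ n
    nonzero  : (M′ *ᵥ v) i ≢ 0ℤ
    smaller  : ∣ (M′ *ᵥ v) i ∣ < b

remainder : ∀ {a} b → a ≢ 0ℤ → ¬ a ℤ∣.∣ b → ∃[ q ] b ℤ.+ q ℤ.* a ≢ 0ℤ × ∣ b ℤ.+ q ℤ.* a ∣ < ∣ a ∣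
remainder {a} b a≢0 a∤b = neg (b / a)
  , (λ r≡0 → a∤b (ℤ∣.divides (b / a) (ℤₚ.i-j≡0⇒i≡j b _ (trans (negate b (b / a) a) r≡0))))
  , subst (λ r → ∣ r ∣ < ∣ a ∣) (sym r≡b%a) (n%d<d b a)
  where
  instance _ = ≢-nonZero a≢0

  negate : ∀ b q a → b ℤ.- q ℤ.* a ≡ b ℤ.+ neg q ℤ.* a
  negate = solve-∀

  cancel : ∀ r q a → (r ℤ.+ q ℤ.* a) ℤ.+ neg q ℤ.* a ≡ r
  cancel = solve-∀

  r≡b%a : b ℤ.+ neg (b / a) ℤ.* a ≡ + (b % a)
  r≡b%a = trans (cong (ℤ._+ neg (b / a) ℤ.* a) (a≡a%n+[a/n]*n b a)) (cancel (+ (b % a)) (b / a) a)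

-- A Euclidean step by a row operation: a multiple of row `i` is added to row `k`, so that entry `k`
-- becomes its nonzero remainder modulo entry `i`.
improve-column : ∀ {m n} (M : Matrix m n) i k v → (M *ᵥ v) i ≢ 0ℤ → ¬ (M *ᵥ v) i ℤ∣.∣ (M *ᵥ v) k →
  Improvement M ∣ (M *ᵥ v) i ∣
improve-column M i k v a≢0 a∤b with q , r≢0 , r<a ← remainder ((M *ᵥ v) k) a≢0 a∤b = record
  { M′      = shear c i M
  ; same    = shear-cokernel c i cᵢ≡0 M
  ; divides = shear-Divides c i
  ; i       = k
  ; v       = v
  ; nonzero = subst (_≢ 0ℤ) (sym entry) r≢0
  ; smaller = subst (λ r → ∣ r ∣ < ∣ (M *ᵥ v) i ∣) (sym entry) r<a
  }
  where
  c : Vector ℤ _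
  c j = q ℤ.* δ k j

  cᵢ≡0 : c i ≡ 0ℤ
  -- The indices differ, since the entry at `i` divides itself.
  cᵢ≡0 = trans (cong (q ℤ.*_) (δ-off-diagonal {i = k} {i} λ { refl → a∤b ℤ∣.∣-refl })) (ℤₚ.*-zeroʳ q)

  entry : (shear c i M *ᵥ v) k ≡ (M *ᵥ v) k ℤ.+ q ℤ.* (M *ᵥ v) i
  entry = trans (dot-linearˡ (M k) (M i) (c k) v)
    (cong (λ s → (M *ᵥ v) k ℤ.+ s ℤ.* (M *ᵥ v) i) (trans (cong (q ℤ.*_) (δ-diagonal k)) (ℤₚ.*-identityʳ q)))

-- The Euclidean step by a column operation: the matrix stays, and the new combination of columns
-- has the remainder of `M i l` as its entry `i`.
improve-row : ∀ {m n} (M : Matrix m n) i l v → (M *ᵥ v) i ≢ 0ℤ → ¬ (M *ᵥ v) i ℤ∣.∣ M i l →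
  Improvement M ∣ (M *ᵥ v) i ∣
improve-row M i l v a≢0 a∤b with q , r≢0 , r<a ← remainder (M i l) a≢0 a∤b = record
  { M′      = M
  ; same    = ≅-refl {cokernel M}
  ; divides = id
  ; i       = i
  ; v       = λ j → δ l j ℤ.+ q ℤ.* v j
  ; nonzero = subst (_≢ 0ℤ) (sym entry) r≢0
  ; smaller = subst (λ r → ∣ r ∣ < ∣ (M *ᵥ v) i ∣) (sym entry) r<a
  }
  where
  entry : (M *ᵥ (λ j → δ l j ℤ.+ q ℤ.* v j)) i ≡ M i l ℤ.+ q ℤ.* (M *ᵥ v) i
  entry = trans (dot-linearʳ (M i) (δ l) q v) (cong (ℤ._+ q ℤ.* (M *ᵥ v) i) (dot-δ (M i) l))

-- The vector v′ keeps the i-th entry of M v and makes the k-th one indivisible by it.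
improve-entry : ∀ {m n} (M : Matrix m n) i k l v → (M *ᵥ v) i ≢ 0ℤ → (M *ᵥ v) i ℤ∣.∣ M i l →
  (M *ᵥ v) i ℤ∣.∣ (M *ᵥ v) k → ¬ (M *ᵥ v) i ℤ∣.∣ M k l → Improvement M ∣ (M *ᵥ v) i ∣
improve-entry M i k l v a≢0 (ℤ∣.divides w Mil≡wa) a∣Mvk a∤Mkl =
  subst (Improvement M ∘ ∣_∣) v′ᵢ (improve-column M i k v′ (subst (_≢ 0ℤ) (sym v′ᵢ) a≢0)
    λ a∣v′ₖ → a∤Mkl (ℤ∣.∣m+n∣n⇒∣m (subst₂ ℤ∣._∣_ v′ᵢ (entry k) a∣v′ₖ) (ℤ∣.∣n⇒∣m*n (1ℤ ℤ.- w) a∣Mvk)))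
  where
  v′ : Vector ℤ _
  v′ j = δ l j ℤ.+ (1ℤ ℤ.- w) ℤ.* v j

  entry : ∀ j → (M *ᵥ v′) j ≡ M j l ℤ.+ (1ℤ ℤ.- w) ℤ.* (M *ᵥ v) j
  entry j = trans (dot-linearʳ (M j) (δ l) (1ℤ ℤ.- w) v) (cong (ℤ._+ (1ℤ ℤ.- w) ℤ.* (M *ᵥ v) j) (dot-δ (M j) l))

  simplify : ∀ w a → w ℤ.* a ℤ.+ (1ℤ ℤ.- w) ℤ.* a ≡ a
  simplify = solve-∀

  v′ᵢ : (M *ᵥ v′) i ≡ (M *ᵥ v) i
  v′ᵢ = trans (entry i) (trans (cong (ℤ._+ (1ℤ ℤ.- w) ℤ.* (M *ᵥ v) i) Mil≡wa) (simplify w _))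

-- The row and the column are tested first, since `improve-entry` relies on both divisibilities. If
-- every test succeeds, the quotients are the `w` and `y` of a pivot, and divisibility of the whole
-- matrix continues the chain.
improve-or-pivot : ∀ {m n} (M : Matrix (suc m) n) i v → (M *ᵥ v) i ≢ 0ℤ →
  Improvement M ∣ (M *ᵥ v) i ∣ ⊎ Σ[ P ∈ Pivot M ] Divides (Pivot.a P) M
improve-or-pivot M i v a≢0 with all? (λ l → (M *ᵥ v) i ℤ∣.∣? M i l)
... | no a∤row with l , a∤Mil ← ¬∀⟶∃¬ _ _ (λ l → (M *ᵥ v) i ℤ∣.∣? M i l) a∤row =
  inj₁ (improve-row M i l v a≢0 a∤Mil)
... | yes a∣row with all? (λ k → (M *ᵥ v) i ℤ∣.∣? (M *ᵥ v) k)
...   | no a∤column with k , a∤Mvk ← ¬∀⟶∃¬ _ _ (λ k → (M *ᵥ v) i ℤ∣.∣? (M *ᵥ v) k) a∤column =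
  inj₁ (improve-column M i k v a≢0 a∤Mvk)
...   | yes a∣column with all? (λ k → all? (λ l → (M *ᵥ v) i ℤ∣.∣? M k l))
...     | no a∤M
  with k , a∤Mk ← ¬∀⟶∃¬ _ _ (λ k → all? (λ l → (M *ᵥ v) i ℤ∣.∣? M k l)) a∤M
  with l , a∤Mkl ← ¬∀⟶∃¬ _ _ (λ l → (M *ᵥ v) i ℤ∣.∣? M k l) a∤Mk =
  inj₁ (improve-entry M i k l v a≢0 (a∣row l) (a∣column k) a∤Mkl)
...     | yes a∣M = inj₂ (record
  { a      = a
  ; i      = i
  ; v      = v
  ; y      = λ k → ℤ∣.quotient (a∣column k)
  ; w      = λ l → ℤ∣.quotient (a∣row l)
  ; yᵢ≡1   = ℤₚ.*-cancelʳ-≡ _ 1ℤ a (trans (sym (ℤ∣._∣_.equality (a∣column i))) (sym (ℤₚ.*-identityˡ a)))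
  ; row    = λ l → trans (ℤ∣._∣_.equality (a∣row l)) (ℤₚ.*-comm _ a)
  ; column = λ k → trans (ℤ∣._∣_.equality (a∣column k)) (ℤₚ.*-comm _ a)
  } , a∣M)
  where
  a = (M *ᵥ v) i
  instance _ = ≢-nonZero a≢0

-- Splits a free summand `ℤ/ 0` off a zero matrix. Every integer divides 0, so such factors fit at
-- the end of the chain.
zero-pivot : ∀ {m n} {M : Matrix (suc m) n} → (∀ k l → M k l ≡ 0ℤ) → Pivot M
zero-pivot {M = M} M≡0 = record
  { a      = 0ℤ
  ; i      = zero
  ; v      = λ _ → 0ℤ
  ; y      = λ _ → 1ℤ
  ; w      = λ _ → 0ℤ
  ; yᵢ≡1   = refl
  ; row    = M≡0 zero
  ; column = λ k → dot-zeroʳ (M k)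
  }

-- The outer recursion removes one row per pivot. Before each pivot, `descend` shrinks a nonzero
-- entry of `M *ᵥ v`, starting from a nonzero matrix entry with `v` a basis vector, until it divides
-- the whole matrix.
smith : ∀ m {n g} (M : Matrix m n) → Divides (+ g) M → Smith g M
smith zero M g∣M = record
  { factors   = []
  ; length≡m  = refl
  ; chain     = [-]
  ; decompose = record
    { hom    = record { to = _ ; ≈-cong = _ ; ∙-homo = _ }
    ; kernel = λ x _ → member⇒≈ε (ℤ^ 0) (image M) {x} ((λ _ → 0ℤ) , λ ())
    ; onto   = λ _ → (λ ()) , _
    }
  }
smith (suc m) {n} M g∣M with all? (λ k → all? (λ l → M k l ℤₚ.≟ 0ℤ))
... | yes M≡0 = pivot-Smith (zero-pivot M≡0) (_ ∣0)
  -- Divisibility by 0 passes to the remaining matrix, so all later factors are divisible by 0 and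
  -- the chain goes on.
  (smith m _ (rest-Divides (zero-pivot M≡0) λ k l → ℤ∣.∣-reflexive (sym (M≡0 k l))))
... | no M≢0
  with k , Mk≢0 ← ¬∀⟶∃¬ _ _ (λ k → all? (λ l → M k l ℤₚ.≟ 0ℤ)) M≢0
  with l , Mkl≢0 ← ¬∀⟶∃¬ _ _ (λ l → M k l ℤₚ.≟ 0ℤ) Mk≢0 =
  descend M g∣M k (δ l) (subst (_≢ 0ℤ) (sym (dot-δ (M k) l)) Mkl≢0) (<-wellFounded _)
  where
  descend : ∀ {g} (M : Matrix (suc m) n) → Divides (+ g) M → ∀ i v → (M *ᵥ v) i ≢ 0ℤ →
    Acc _<_ ∣ (M *ᵥ v) i ∣ → Smith g M
  descend M g∣M i v a≢0 (acc rs) with improve-or-pivot M i v a≢0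
  ... | inj₁ better = record { Smith S ; decompose = same ⨾ Smith.decompose S }
    where
    open Improvement better using (M′; same; divides; nonzero; smaller)
    S = descend M′ (divides g∣M) _ _ nonzero (rs smaller)
  ... | inj₂ (P , a∣M) = pivot-Smith P
    (ℤ∣.∣⇒∣ᵤ (subst (_ ℤ∣.∣_) (Pivot.pivot-entry P) (∣-dot (Pivot.v P) (g∣M (Pivot.i P)))))
    (smith m (rest P) (rest-Divides P λ k l → ℤ∣.∣-trans ℤ∣.∣m∣∣m (a∣M k l)))

-- The number of components is an invariant

open InvariantFactorDecomposition using (factors; factors>1; chain; components)

decomposition-≅ : ∀ {A} (D : InvariantFactorDecomposition A) → A ≅ cyclics (factors D)
decomposition-≅ {A} D = record
  { hom    = record { to = to ; ≈-cong = ⟦⟧-cong ; ∙-homo = ∙-homo }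
  ; kernel = λ x p → injective (B.trans p (B.sym ε-homo))
  ; onto   = λ y → let (x , p) = surjective y in x , p A.refl
  }
  where
  open InvariantFactorDecomposition D using (to; isIsomorphism)
  open IsGroupIsomorphism isIsomorphism
  module A = AbelianGroup A
  module B = AbelianGroup (cyclics (factors D))

^-reflects-≤ : ∀ {p m n} → 1 < p → p ^ m ≤ p ^ n → m ≤ n
^-reflects-≤ {p} 1<p pᵐ≤pⁿ = ℕₚ.≮⇒≥ λ n<m → ℕₚ.<⇒≱ (ℕₚ.^-monoʳ-< p 1<p n<m) pᵐ≤pⁿ

-- The map `s` factors through A/pA and is onto, so A/pA has at least `p ^ k` elements, while a
-- decomposition allows at most `p` per component.
components-lower-bound : ∀ {A p} k → (1<p : 1 < p) → let instance _ = >-nonZero (ℕₚ.<-trans z<s 1<p) in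
  (s : ∣ A ∣ᴬ → Fin (p ^ k)) → (∀ {x y} → Congruent p A x y → s x ≡ s y) → (∀ i → ∃[ x ] s x ≡ i) →
  (D : InvariantFactorDecomposition A) → k ≤ components D
components-lower-bound {p = p} k 1<p s s-cong s-onto D =
  ^-reflects-≤ 1<p (quotient-bound p (factors D) (decomposition-≅ D) s s-cong s-onto)
  where instance _ = >-nonZero (ℕₚ.<-trans z<s 1<p)

components-unique-≤ : ∀ {A} (D D′ : InvariantFactorDecomposition A) → components D ≤ components D′
components-unique-≤ {A} D D′ = bound (factors D) (factors>1 D) (chain D) (decomposition-≅ D)
  where
  bound : ∀ as → All (1 <_) as → Linked _∣_ as → A ≅ cyclics as → length as ≤ components D′
  bound []       _         _     _ = z≤n
  -- The first factor divides all the later ones, so the residues modulo `p` are defined on every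
  -- summand and separate `p ^ length (p ∷ as)` classes.
  bound (p ∷ as) (1<p ∷ _) chain f = components-lower-bound (length (p ∷ as)) 1<p
    (residues p (p ∷ as) ∘ to)
    (respects ∘ Congruent-cong p hom)
    onto-residues
    D′
    where
    open _≅_ f
    instance _ = >-nonZero (ℕₚ.<-trans z<s 1<p)

    respects : ∀ {x y} → Congruent p (cyclics (p ∷ as)) x y → residues p (p ∷ as) x ≡ residues p (p ∷ as) y
    respects = Congruent⇒residues-≡ p (Linkedₚ.Linked⇒All ∣-trans ∣-refl chain)

    onto-residues : ∀ i → ∃[ x ] residues p (p ∷ as) (to x) ≡ i
    onto-residues i
      with y , y↦i ← residues-surjective p (p ∷ as) i
      with x , x↦y ← onto y =
      x , trans (respects {to x} {y} (≈⇒Congruent p (cyclics (p ∷ as)) x↦y)) y↦i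

-- Some factor is 0 and is lost in the filter: the free part of the cokernel costs one component.
nontrivial-shorter : ∀ as → ¬ All (0 <_) as → length (nontrivial as) < length as
nontrivial-shorter as ¬0<as = filter-notAll (1 ℕₚ.<?_) as
  (Any.map (λ 0≮a 1<a → 0≮a (ℕₚ.<-trans z<s 1<a)) (¬All⇒Any¬ (0 ℕₚ.<?_) as ¬0<as))

-- Arithmetical structures and the free part of the cokernel

dot-*ᵥ : ∀ {m n} y (M : Matrix m n) z → dot y (M *ᵥ z) ≡ dot (λ j → dot y (λ i → M i j)) z
dot-*ᵥ {m} {n} y M z = begin
  ∑ℤ (λ i → y i ℤ.* dot (M i) z)                    ≡⟨ sum-cong-≗ {m} (λ i → *-distribˡ-sum (y i) (λ j → M i j ℤ.* z j)) ⟩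
  ∑ℤ (λ i → ∑ℤ (λ j → y i ℤ.* (M i j ℤ.* z j)))     ≡⟨ ∑-comm (λ i j → y i ℤ.* (M i j ℤ.* z j)) ⟩
  ∑ℤ (λ j → ∑ℤ (λ i → y i ℤ.* (M i j ℤ.* z j)))     ≡⟨ sum-cong-≗ {n} (λ j → trans
                                                         (sum-cong-≗ {m} λ i → sym (ℤₚ.*-assoc (y i) (M i j) (z j)))
                                                         (sym (*-distribʳ-sum (z j) λ i → y i ℤ.* M i j))) ⟩
  dot (λ j → dot y (λ i → M i j)) z                 ∎

dot-congˡ : ∀ {n} {a b : Vector ℤ n} z → (∀ j → a j ≡ b j) → dot a z ≡ dot b z
dot-congˡ {n} z a≡b = sum-cong-≗ {n} λ j → cong (ℤ._* z j) (a≡b j)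

dot-congʳ : ∀ {n} (a : Vector ℤ n) {y z} → (∀ j → y j ≡ z j) → dot a y ≡ dot a z
dot-congʳ {n} a y≡z = sum-cong-≗ {n} λ j → cong (a j ℤ.*_) (y≡z j)

dot-δˡ : ∀ {n} i (z : Vector ℤ n) → dot (δ i) z ≡ z i
dot-δˡ i z = trans (dot-comm (δ i) z) (dot-δ z i)

pos-dot : ∀ {n} (a z : Vector ℕ n) → dot (+_ ∘ a) (+_ ∘ z) ≡ + ∑ℕ (λ j → a j ℕ.* z j)
pos-dot {zero}  a z = refl
pos-dot {suc n} a z = trans
  (cong₂ ℤ._+_ (sym (ℤₚ.pos-* (a zero) (z zero))) (pos-dot (a ∘ suc) (z ∘ suc)))
  (sym (ℤₚ.pos-+ (a zero ℕ.* z zero) _))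

multiple-coker : ∀ {m n} (M : Matrix m n) k x i → multiple (cokernel M) k x i ≡ + k ℤ.* x i
multiple-coker M zero    x i = refl
multiple-coker M (suc k) x i =
  trans (cong (λ y → x i ℤ.+ y) (multiple-coker M k x i)) (sym (ℤₚ.suc-* (+ k) (x i)))

module _ {G : Graph} (S : ArithmeticalStructure G) where
  open Graph G
  open ArithmeticalStructure S

  private
    -- Separates the adjacency part from a multiple of a basis vector, so that the pairing with `r`
    -- can be computed by linearity.
    L-column : ∀ u v → L u v ≡ neg (+ adj u v) ℤ.+ + d v ℤ.* δ v u
    L-column u v with u ≟ v
    ... | yes refl = trans (ℤₚ.+-comm (+ d v) (neg (+ adj v v))) (cong (λ s → neg (+ adj v v) ℤ.+ s)
      (sym (trans (cong (+ d v ℤ.*_) (δ-diagonal v)) (ℤₚ.*-identityʳ (+ d v)))))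
    ... | no u≢v   = trans (ℤₚ.+-comm 0ℤ (neg (+ adj u v))) (cong (λ s → neg (+ adj u v) ℤ.+ s)
      (sym (trans (cong (+ d v ℤ.*_) (δ-off-diagonal {i = v} {u} (u≢v ∘ sym))) (ℤₚ.*-zeroʳ (+ d v)))))

    R : Vector ℤ order
    R u = + r u

  -- The balance condition concerns the rows of `L`; symmetry of the adjacency matrix transfers it
  -- to the columns.
  r-annihilates-columns : ∀ v → dot R (λ u → L u v) ≡ 0ℤ
  r-annihilates-columns v = begin
    dot R (λ u → L u v)                                        ≡⟨ dot-congʳ R (λ u → L-column u v) ⟩
    dot R (λ u → neg (+ adj u v) ℤ.+ + d v ℤ.* δ v u)          ≡⟨ dot-linearʳ R (λ u → neg (+ adj u v)) (+ d v) (δ v) ⟩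
    dot R (λ u → neg (+ adj u v)) ℤ.+ + d v ℤ.* dot R (δ v)    ≡⟨ cong₂ (λ s t → s ℤ.+ + d v ℤ.* t) neighbours (dot-δ R v) ⟩
    -1ℤ ℤ.* (+ r v ℤ.* + d v) ℤ.+ + d v ℤ.* + r v              ≡⟨ cancel (+ r v) (+ d v) ⟩
    0ℤ                                                         ∎
    where
    cancel : ∀ r d → -1ℤ ℤ.* (r ℤ.* d) ℤ.+ d ℤ.* r ≡ 0ℤ
    cancel = solve-∀

    neighbours : dot R (λ u → neg (+ adj u v)) ≡ -1ℤ ℤ.* (+ r v ℤ.* + d v)
    neighbours = begin
      dot R (λ u → neg (+ adj u v))                ≡⟨ dot-comm R _ ⟩
      dot (λ u → neg (+ adj u v)) R                ≡⟨ dot-scale -1ℤ R (λ u → trans (cong (λ e → neg (+ e)) (symmetric u v)) (sym (ℤₚ.-1*i≡-i (+ adj v u)))) ⟩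
      -1ℤ ℤ.* dot (λ u → + adj v u) R              ≡⟨ cong (-1ℤ ℤ.*_) (pos-dot (adj v) r) ⟩
      -1ℤ ℤ.* + ∑ℕ (λ u → adj v u ℕ.* r u)         ≡⟨ cong (λ s → -1ℤ ℤ.* + s) (balanced v) ⟨
      -1ℤ ℤ.* + (r v ℕ.* d v)                      ≡⟨ cong (-1ℤ ℤ.*_) (ℤₚ.pos-* (r v) (d v)) ⟩
      -1ℤ ℤ.* (+ r v ℤ.* + d v)                    ∎

  r-annihilates-image : ∀ z → dot R (L *ᵥ z) ≡ 0ℤ
  r-annihilates-image z = trans (dot-*ᵥ R L z) (dot-scale {b = λ _ → 0ℤ} 0ℤ z r-annihilates-columns)

  -- Pairing with r vanishes on the image of L but not on any multiple of a basis vector.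
  cokernel-not-torsion : Fin order → ¬ (∀ x → Torsion (cokernel L) x)
  cokernel-not-torsion v torsion-δ
    with k , 0<k , kδ≈0 ← torsion-δ (δ v)
    with z , kδ≡Lz ← ≈ε⇒member (ℤ^ order) (image L) {multiple (cokernel L) k (δ v)} kδ≈0 =
    ℕₚ.<-irrefl (sym (ℤₚ.+-injective (trans (ℤₚ.pos-* k (r v)) vanishes))) (ℕₚ.*-mono-< 0<k (r-positive v))
    where
    vanishes : + k ℤ.* + r v ≡ 0ℤ
    vanishes = begin
      + k ℤ.* + r v                                ≡⟨ cong (+ k ℤ.*_) (dot-δˡ v R) ⟨
      + k ℤ.* dot (δ v) R                          ≡⟨ dot-scale (+ k) R (multiple-coker L k (δ v)) ⟨
      dot (multiple (cokernel L) k (δ v)) R        ≡⟨ dot-congˡ R kδ≡Lz ⟩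
      dot (L *ᵥ z) R                               ≡⟨ dot-comm (L *ᵥ z) R ⟩
      dot R (L *ᵥ z)                               ≡⟨ r-annihilates-image z ⟩
      0ℤ                                           ∎

  -- A sum of cyclic groups of positive orders is torsion, whereas the cokernel is not. The vertex
  -- provides the basis vector that is not torsion.
  smith-factors-not-positive : Fin order → (N : Smith 1 L) → ¬ All (0 <_) (Smith.factors N)
  smith-factors-not-positive v N 0<factors = cokernel-not-torsion v λ x →
    torsion-reflects {cokernel L} {cyclics (Smith.factors N)} (Smith.decompose N)
      (cyclics-torsion 0<factors (_≅_.to (Smith.decompose N) x))

-- The upper bound

torsion-components-≤ : ∀ {A k} as → Linked _∣_ as → A ≅ cyclics as → length (nontrivial as) ≤ k →
  NumberOfComponents (torsion A) (_≤ k)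
torsion-components-≤ {A} as chain f ≤k =
  torsion-decomposition {A} as chain f ,
  λ D → ℕₚ.≤-trans (components-unique-≤ {torsion A} D (torsion-decomposition {A} as chain f)) ≤k

components-bound : ∀ {G k} (S : ArithmeticalStructure G) (N : Smith 1 (ArithmeticalStructure.L S)) →
  length (nontrivial (Smith.factors N)) ≤ k → NumberOfComponents (criticalGroup S) (_≤ k)
components-bound {k = k} S N ≤k = torsion-components-≤ {cokernel (ArithmeticalStructure.L S)} {k}
  (Smith.factors N) (Linked.tail (Smith.chain N)) (Smith.decompose N) ≤k

-- A simple edge puts the unit -1 into `L`, and dividing by it is negation. The resulting summand is
-- `ℤ/ 1`.
unit-pivot : ∀ {m n} (M : Matrix (suc m) n) i j → M i j ≡ -1ℤ → Pivot M
unit-pivot M i j Mij≡-1 = record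
  { a      = -1ℤ
  ; i      = i
  ; v      = δ j
  ; y      = λ k → neg (M k j)
  ; w      = λ l → neg (M i l)
  ; yᵢ≡1   = cong neg Mij≡-1
  ; row    = λ l → double-negation (M i l)
  ; column = λ k → trans (dot-δ (M k) j) (double-negation (M k j))
  }
  where
  double-negation : ∀ x → x ≡ -1ℤ ℤ.* neg x
  double-negation = solve-∀

1-Divides : ∀ {m n} (M : Matrix m n) → Divides (+ 1) M
1-Divides M k l = ℤ∣.divides (M k l) (sym (ℤₚ.*-identityʳ _))

-- Of the `n + 2` factors, the pivot gives one equal to 1, and one of the other `n + 1` is 0.
complete-bound : ∀ n (S : ArithmeticalStructure K[ suc (suc n) ]) →
  NumberOfComponents (criticalGroup S) (_≤ n)
complete-bound n S = components-bound S N
  (ℕₚ.≤-pred (subst (length (nontrivial (Smith.factors N′)) <_) (Smith.length≡m N′)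
    (nontrivial-shorter (Smith.factors N′) λ 0<as → smith-factors-not-positive S zero N (z<s ∷ 0<as))))
  where
  open ArithmeticalStructure S using (L)

  P : Pivot L
  P = unit-pivot L zero (suc zero) refl

  N′ : Smith 1 (Pivot.rest P)
  N′ = smith (suc n) (Pivot.rest P) (1-Divides (Pivot.rest P))

  N : Smith 1 L
  N = pivot-Smith P ∣-refl N′

-- Of the `n + 3` factors, the two pivots give two equal to 1, and one of the other `n + 1` is 0.
star-bound : ∀ n (S : ArithmeticalStructure S[ suc (suc n) ]) →
  NumberOfComponents (criticalGroup S) (_≤ n)
star-bound n S = components-bound S N
  (ℕₚ.≤-pred (subst (length (nontrivial (Smith.factors N′)) <_) (Smith.length≡m N′)
    (nontrivial-shorter (Smith.factors N′) λ 0<as → smith-factors-not-positive S zero N (z<s ∷ z<s ∷ 0<as))))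
  where
  open ArithmeticalStructure S using (L)

  P : Pivot L
  P = unit-pivot L zero (suc zero) refl

  P′ : Pivot (Pivot.rest P)
  -- Row `suc zero` of the remaining matrix belongs to the second leaf. That leaf is not adjacent to
  -- the first, so the first pivot leaves its row unchanged, with -1 in the column of the centre.
  P′ = unit-pivot (Pivot.rest P) (suc zero) zero refl

  N′ : Smith 1 (Pivot.rest P′)
  N′ = smith (suc n) (Pivot.rest P′) (1-Divides (Pivot.rest P′))

  N : Smith 1 L
  N = pivot-Smith P ∣-refl (pivot-Smith P′ ∣-refl N′)

funToFin-cong : ∀ {m n} {f g : Fin m → Fin n} → (∀ i → f i ≡ g i) → funToFin f ≡ funToFin g
funToFin-cong {zero}  f≡g = refl
funToFin-cong {suc m} f≡g = cong₂ combine (f≡g zero) (funToFin-cong (f≡g ∘ suc))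

-- Sharpness

-- If the rows ι i and b of M agree modulo p, then x ↦ (x (ι i) − x b)ᵢ maps the cokernel to (ℤ/p)ᵏ;
-- the vectors x with M x = p x are torsion and make this map onto.
module _ {m p k} (1<p : 1 < p) (M : Matrix m m) (b : Fin m) (ι : Fin k → Fin m)
  (rows-agree : ∀ i l → + p ℤ∣.∣ M (ι i) l ℤ.- M b l)
  (eigenvectors : ∀ (c : Vector ℤ k) →
    ∃[ x ] (∀ j → (M *ᵥ x) j ≡ + p ℤ.* x j) × (∀ i → x (ι i) ℤ.- x b ≡ c i)) where

  private
    instance _ = >-nonZero (ℕₚ.<-trans z<s 1<p)

    s : Vector ℤ m → Fin (p ^ k)
    s x = funToFin λ i → residue p (x (ι i) ℤ.- x b)

    -- Congruence gives `x = y + p u + M z`. Subtracting coordinate `b` from coordinate `ι i` leaves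
    -- a multiple of `p` and a difference of two rows applied to `z`, which `p` divides.
    s-cong : ∀ {x y} → Congruent p (cokernel M) x y → s x ≡ s y
    s-cong {x} {y} (by u (z , p≡)) = funToFin-cong λ i → ∣⇒residue-≡ p (x (ι i) ℤ.- x b) (y (ι i) ℤ.- y b)
      (subst (+ p ℤ∣.∣_) (difference i) (ℤ∣.∣m∣n⇒∣m+n (p∣M i) (ℤ∣.divides (u (ι i) ℤ.- u b) refl)))
      where
      p∣M : ∀ i → + p ℤ∣.∣ (M *ᵥ z) (ι i) ℤ.+ -1ℤ ℤ.* (M *ᵥ z) b
      p∣M i = subst (+ p ℤ∣.∣_) (dot-linearˡ (M (ι i)) (M b) -1ℤ z)
        (∣-dot z λ l → subst (λ t → + p ℤ∣.∣ M (ι i) l ℤ.+ t) (sym (ℤₚ.-1*i≡-i (M b l))) (rows-agree i l))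

      at : ∀ j → x j ℤ.- (y j ℤ.+ + p ℤ.* u j) ≡ (M *ᵥ z) j
      at j = trans (cong (λ t → x j ℤ.- (y j ℤ.+ t)) (sym (multiple-coker M p u j))) (p≡ j)

      regroup : ∀ x y u x′ y′ u′ p →
        ((x ℤ.- (y ℤ.+ p ℤ.* u)) ℤ.+ -1ℤ ℤ.* (x′ ℤ.- (y′ ℤ.+ p ℤ.* u′))) ℤ.+ (u ℤ.- u′) ℤ.* p ≡
        (x ℤ.- x′) ℤ.- (y ℤ.- y′)
      regroup = solve-∀

      difference : ∀ i → ((M *ᵥ z) (ι i) ℤ.+ -1ℤ ℤ.* (M *ᵥ z) b) ℤ.+ (u (ι i) ℤ.- u b) ℤ.* + p ≡
        (x (ι i) ℤ.- x b) ℤ.- (y (ι i) ℤ.- y b)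
      difference i = trans
        (cong₂ (λ s t → (s ℤ.+ -1ℤ ℤ.* t) ℤ.+ (u (ι i) ℤ.- u b) ℤ.* + p) (sym (at (ι i))) (sym (at b)))
        (regroup (x (ι i)) (y (ι i)) (u (ι i)) (x b) (y b) (u b) (+ p))

  eigenvectors⇒components-≥ : (D : InvariantFactorDecomposition (torsion (cokernel M))) → k ≤ components D
  eigenvectors⇒components-≥ = components-lower-bound k 1<p (s ∘ proj₁)
    (s-cong ∘ Congruent-cong p (torsion-inclusion (cokernel M))) s-onto
    where
    s-onto : ∀ i → ∃[ x ] s (proj₁ x) ≡ i
    -- The `k` digits of `i` in base `p` are the coordinate differences to be realised. Since `p x`
    -- equals `M x`, the vector `x` is killed by `p` in the cokernel.
    s-onto i with x , Mx≡px , x≡c ← eigenvectors (λ j → + toℕ (finToFun i j)) =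
      (x , p , ℕₚ.<-trans z<s 1<p , member⇒≈ε (ℤ^ m) (image M) {multiple (cokernel M) p x}
        (x , λ j → trans (multiple-coker M p x j) (sym (Mx≡px j))))
      , trans (funToFin-cong λ j → trans (cong (residue p) (x≡c j)) (residue-toℕ p (finToFun i j)))
              (funToFin-finToFin {k} {p} i)

∑ℕ-const : ∀ n c → ∑ℕ {n} (λ _ → c) ≡ n ℕ.* c
∑ℕ-const zero    c = refl
∑ℕ-const (suc n) c = cong (c ℕ.+_) (∑ℕ-const n c)

-- The critical group is (ℤ/m)ᵐ⁻² for m = n + 2, and likewise for the star below.
complete-structure : ∀ n → ArithmeticalStructure K[ suc (suc n) ]
complete-structure n = record
  { d          = λ _ → suc n
  ; r          = λ _ → 1
  ; r-positive = λ _ → z<s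
  ; r-coprime  = λ k k∣r → ∣1⇒≡1 (k∣r zero)
  ; balanced   = λ v → trans (ℕₚ.*-identityˡ (suc n)) (sym (degree v))
  }
  where
  degree : ∀ {n} (v : Fin (suc n)) → ∑ℕ (λ u → (if does (v ≟ u) then 0 else 1) ℕ.* 1) ≡ n
  degree {n}     zero    = trans (∑ℕ-const n 1) (ℕₚ.*-identityʳ n)
  degree {suc n} (suc v) = cong suc (degree v)

complete-components : ∀ n (D : InvariantFactorDecomposition (criticalGroup (complete-structure n))) →
  n ≤ components D
complete-components n = eigenvectors⇒components-≥ (s≤s z<s) L zero (λ i → suc (suc i)) rows-agree
  λ c → balance c , eigenvector c , λ i → ℤₚ.+-identityʳ (c i)
  where
  open ArithmeticalStructure (complete-structure n) using (L)

  -- The matrix is `n + 2` times the identity minus the all-ones matrix. So its rows agree modulo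
  -- `n + 2`, and vectors with coordinate sum 0 are eigenvectors for `n + 2`.
  L-entry : ∀ u v → L u v ≡ -1ℤ ℤ.+ + (2 ℕ.+ n) ℤ.* δ u v
  L-entry u v with u ≟ v
  ... | yes _ = trans (ℤₚ.+-identityʳ (+ suc n)) (sym (cong (λ t → -1ℤ ℤ.+ t) (ℤₚ.*-identityʳ (+ (2 ℕ.+ n)))))
  ... | no _  = sym (cong (λ t → -1ℤ ℤ.+ t) (ℤₚ.*-zeroʳ (+ (2 ℕ.+ n))))

  rows-agree : ∀ i l → + (2 ℕ.+ n) ℤ∣.∣ L (suc (suc i)) l ℤ.- L zero l
  rows-agree i l = ℤ∣.divides (δ (suc (suc i)) l ℤ.- δ zero l)
    (trans (cong₂ ℤ._-_ (L-entry (suc (suc i)) l) (L-entry zero l))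
      (factor (+ (2 ℕ.+ n)) (δ (suc (suc i)) l) (δ zero l)))
    where
    factor : ∀ p s t → (-1ℤ ℤ.+ p ℤ.* s) ℤ.- (-1ℤ ℤ.+ p ℤ.* t) ≡ (s ℤ.- t) ℤ.* p
    factor = solve-∀

  -- The base coordinate is 0, so the differences are the entries of `c`; the second coordinate
  -- makes the total 0.
  balance : Vector ℤ n → Vector ℤ (2 ℕ.+ n)
  balance c zero          = 0ℤ
  balance c (suc zero)    = dot (λ _ → -1ℤ) c
  balance c (suc (suc i)) = c i

  balanced-sum : ∀ t → -1ℤ ℤ.* 0ℤ ℤ.+ (-1ℤ ℤ.* t ℤ.+ t) ≡ 0ℤ
  balanced-sum = solve-∀

  eigenvector : ∀ c j → (L *ᵥ balance c) j ≡ + (2 ℕ.+ n) ℤ.* balance c j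
  eigenvector c j = begin
    (L *ᵥ x) j                                                ≡⟨ dot-congˡ x (L-entry j) ⟩
    dot (λ l → -1ℤ ℤ.+ + (2 ℕ.+ n) ℤ.* δ j l) x               ≡⟨ dot-linearˡ (λ _ → -1ℤ) (δ j) (+ (2 ℕ.+ n)) x ⟩
    dot (λ _ → -1ℤ) x ℤ.+ + (2 ℕ.+ n) ℤ.* dot (δ j) x         ≡⟨ cong₂ (λ s t → s ℤ.+ + (2 ℕ.+ n) ℤ.* t)
                                                                   (balanced-sum (dot (λ _ → -1ℤ) c)) (dot-δˡ j x) ⟩
    0ℤ ℤ.+ + (2 ℕ.+ n) ℤ.* x j                                ≡⟨ ℤₚ.+-identityˡ _ ⟩
    + (2 ℕ.+ n) ℤ.* x j                                       ∎
    where x = balance c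

star-structure : ∀ n → ArithmeticalStructure S[ suc (suc n) ]
star-structure n = record
  { d          = λ { zero → 1 ; (suc _) → 2 ℕ.+ n }
  ; r          = λ { zero → 2 ℕ.+ n ; (suc _) → 1 }
  ; r-positive = λ { zero → z<s ; (suc _) → z<s }
  ; r-coprime  = λ k k∣r → ∣1⇒≡1 (k∣r (suc zero))
  ; balanced   = λ
    { zero    → sym (∑ℕ-const (2 ℕ.+ n) 1)
    ; (suc _) → sym (trans
        (cong (1 ℕ.* (2 ℕ.+ n) ℕ.+_) (trans (∑ℕ-const (2 ℕ.+ n) 0) (ℕₚ.*-zeroʳ n)))
        (ℕₚ.+-identityʳ _))
    }
  }

star-components : ∀ n (D : InvariantFactorDecomposition (criticalGroup (star-structure n))) →
  n ≤ components D
star-components n = eigenvectors⇒components-≥ (s≤s z<s) L (suc zero) (λ i → suc (suc (suc i))) rows-agree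
  λ c → balance c , eigenvector c , λ i → ℤₚ.+-identityʳ (c i)
  where
  open ArithmeticalStructure (star-structure n) using (L)

  -- The block of the leaves is scalar, and each leaf row has the same entry at the centre, so the
  -- leaf rows agree modulo `n + 2`.
  L-leaves : ∀ u v → L (suc u) (suc v) ≡ + (2 ℕ.+ n) ℤ.* δ u v
  L-leaves u v with u ≟ v
  ... | yes _ = trans (ℤₚ.+-identityʳ _) (sym (ℤₚ.*-identityʳ (+ (2 ℕ.+ n))))
  ... | no _  = sym (ℤₚ.*-zeroʳ (+ (2 ℕ.+ n)))

  rows-agree : ∀ i l → + (2 ℕ.+ n) ℤ∣.∣ L (suc (suc (suc i))) l ℤ.- L (suc zero) l
  rows-agree i zero    = ℤ∣.divides 0ℤ refl
  rows-agree i (suc l) = ℤ∣.divides (δ (suc (suc i)) l ℤ.- δ zero l)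
    (trans (cong₂ ℤ._-_ (L-leaves (suc (suc i)) l) (L-leaves zero l))
      (factor (+ (2 ℕ.+ n)) (δ (suc (suc i)) l) (δ zero l)))
    where
    factor : ∀ p s t → p ℤ.* s ℤ.- p ℤ.* t ≡ (s ℤ.- t) ℤ.* p
    factor = solve-∀

  -- With 0 at the centre, each leaf row multiplies its own coordinate by `n + 2`. The second leaf
  -- makes the leaf coordinates sum to 0, as the row of the centre requires; the first leaf is the
  -- base coordinate.
  balance : Vector ℤ n → Vector ℤ (3 ℕ.+ n)
  balance c zero                = 0ℤ
  balance c (suc zero)          = 0ℤ
  balance c (suc (suc zero))    = dot (λ _ → -1ℤ) c
  balance c (suc (suc (suc i))) = c i

  balanced-sum : ∀ t p → 1ℤ ℤ.* 0ℤ ℤ.+ (-1ℤ ℤ.* 0ℤ ℤ.+ (-1ℤ ℤ.* t ℤ.+ t)) ≡ p ℤ.* 0ℤ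
  balanced-sum = solve-∀

  eigenvector : ∀ c j → (L *ᵥ balance c) j ≡ + (2 ℕ.+ n) ℤ.* balance c j
  eigenvector c zero    = balanced-sum (dot (λ _ → -1ℤ) c) (+ (2 ℕ.+ n))
  eigenvector c (suc j) = begin
    -1ℤ ℤ.* 0ℤ ℤ.+ dot (λ l → L (suc j) (suc l)) leaves   ≡⟨ ℤₚ.+-identityˡ _ ⟩
    dot (λ l → L (suc j) (suc l)) leaves                  ≡⟨ dot-scale (+ (2 ℕ.+ n)) leaves (L-leaves j) ⟩
    + (2 ℕ.+ n) ℤ.* dot (δ j) leaves                      ≡⟨ cong (+ (2 ℕ.+ n) ℤ.*_) (dot-δˡ j leaves) ⟩
    + (2 ℕ.+ n) ℤ.* leaves j                              ∎
    where leaves = balance c ∘ suc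

exactly : ∀ A k → NumberOfComponents A (_≤ k) → ((D : InvariantFactorDecomposition A) → k ≤ components D) →
  NumberOfComponents A (_≡ k)
exactly A k (D , ≤k) ≥k = D , λ D′ → ℕₚ.≤-antisym (≤k D′) (≥k D′)

proposition16 : (n : ℕ) → 2 ≤ n →
    ((A : ArithmeticalStructure S[ n ]) → NumberOfComponents (criticalGroup A) (λ t → t ≤ n ∸ 2)) ×
    ((A : ArithmeticalStructure K[ n ]) → NumberOfComponents (criticalGroup A) (λ t → t ≤ n ∸ 2)) ×
    (Σ[ A ∈ ArithmeticalStructure S[ n ] ] NumberOfComponents (criticalGroup A) (λ t → t ≡ n ∸ 2)) ×
    (Σ[ A ∈ ArithmeticalStructure K[ n ] ] NumberOfComponents (criticalGroup A) (λ t → t ≡ n ∸ 2))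
proposition16 (suc zero)    (s≤s ())
proposition16 (suc (suc n)) _ =
  star-bound n ,
  complete-bound n ,
  (star-structure n , exactly (criticalGroup (star-structure n)) n (star-bound n (star-structure n)) (star-components n)) ,
  (complete-structure n , exactly (criticalGroup (complete-structure n)) n (complete-bound n (complete-structure n)) (complete-components n))
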